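{- There is an algorithm that solves the problem $F_2||\sum_{J_j\in E} w_j$ (just-in-time flow-shop scheduling on two machines) with $n$ jobs in $O(n2^k)$ time, where $k=\#d\cdot\#w$. Thus, the problem is fixed-parameter tractable when parameterized by combining the number $\#d$ of different due dates with the number $\#w$ of different weights.
   Context: JIT flow-shop problem $F_m||\sum_{J_j\in E}w_j$: an instance consists of $n$ independent, non-preemptive jobs $\mathcal J=\{J_1,\dots,J_n\}$, all available at time $0$, and $m$ machines $M_1,\dots,M_m$. Job $J_j$ has a processing time $p^{(i)}_j$ on each machine $M_i$, a due date $d_j$ and a weight $w_j$; all these numbers are positive integers. Every scheduled job must be processed first on $M_1$, then on $M_2$, and so on up to $M_m$; its processing on $M_i$ cannot start before its processing on $M_{i-1}$ is completed; each machine processes at most one job at a time; idle time and waiting between machines are allowed, and the processing orders on different machines may differ. A job is scheduled in JIT mode if its processing on $M_m$ is completed exactly at time $d_j$. A partition $\mathcal J=E\cup T$ is feasible if the jobs of $E$ can all be scheduled in JIT mode (jobs of $T$ are rejected and are not processed). The goal is to find a feasible partition maximizing $\sum_{J_j\in E}w_j$. $\#d$ is the number of distinct values among the due dates $d_1,\dots,d_n$, and $\#w$ is the number of distinct values among the weights $w_1,\dots,w_n$. Running times count elementary arithmetic operations and comparisons on the input numbers as single steps. A problem is fixed-parameter tractable (FPT) with respect to a parameter $\kappa$ if every instance $I$ can be solved in $f(\kappa)\cdot|I|^{O(1)}$ time for a computable function $f$ depending only on $\kappa$. The combined parameter here is $\#d+\#w$. -}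

module Defs where

open import Data.Bool.Base using (Bool; true; false; if_then_else_)
open import Data.Fin.Base using (Fin; zero; suc; toℕ)
open import Data.Fin.Subset using (Subset; _∈_)
open import Data.Integer.Base using (+_)
import Data.List.Base as List
open import Data.Nat.Base
open import Data.Nat.Logarithm using (⌊log₂_⌋)
open import Data.Nat.Properties using (_≟_; +-0-monoid)
open import Data.Product.Base using (∃; ∃₂; _×_)
open import Data.Rational.Base as ℚ using (ℚ; 0ℚ)
open import Data.Sum.Base using (_⊎_)
open import Data.Vec.Base using (lookup; tabulate)
open import Data.Vec.Functional using (Vector; _∷_)
open import Relation.Binary.PropositionalEquality using (_≡_; _≢_)
open import Algebra.Properties.Monoid.Sum +-0-monoid using (sum)

------------------------------------------------------------------------
-- Just-in-time flow shops

record Instance (m : ℕ) : Set where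
  field
    n      : ℕ
    proc   : Fin m → Fin n → ℕ    -- proc i j: time of job j on machine i
    due    : Fin n → ℕ
    weight : Fin n → ℕ
    proc>0   : ∀ i j → 0 < proc i j
    due>0    : ∀ j → 0 < due j
    weight>0 : ∀ j → 0 < weight j

open Instance public

fromℕ : ℕ → ℚ
fromℕ x = + x ℚ./ 1

-- The data are integers but start times need not be.  Values of `start` at
-- jobs outside E are irrelevant.
record JITSchedule {m} (I : Instance m) (E : Subset (n I)) : Set where
  field
    start : Fin m → Fin (n I) → ℚ

  completion : Fin m → Fin (n I) → ℚ
  completion i j = start i j ℚ.+ fromℕ (proc I i j)

  field
    released : ∀ i {j} → j ∈ E → 0ℚ ℚ.≤ start i j
    route    : ∀ {i i′} → toℕ i′ ≡ suc (toℕ i) →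
               ∀ {j} → j ∈ E → completion i j ℚ.≤ start i′ j
    capacity : ∀ i {j j′} → j ∈ E → j′ ∈ E → j ≢ j′ →
               completion i j ℚ.≤ start i j′ ⊎ completion i j′ ℚ.≤ start i j
    onTime   : ∀ {i} → suc (toℕ i) ≡ m →
               ∀ {j} → j ∈ E → completion i j ≡ fromℕ (due I j)

-- The partition 𝒥 = E ∪ T is represented by E; T is its complement.
Feasible : ∀ {m} (I : Instance m) → Subset (n I) → Set
Feasible I E = JITSchedule I E

totalWeight : ∀ {m} (I : Instance m) → Subset (n I) → ℕ
totalWeight I E = sum λ j → if lookup E j then weight I j else 0

Optimal : ∀ {m} (I : Instance m) → Subset (n I) → Set
Optimal I E =
  Feasible I E × (∀ E′ → Feasible I E′ → totalWeight I E′ ≤ totalWeight I E)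

#distinct : ∀ {n} → (Fin n → ℕ) → ℕ
#distinct f = List.length (List.deduplicate _≟_ (List.tabulate f))

#d #w : ∀ {m} → Instance m → ℕ
#d I = #distinct (due I)
#w I = #distinct (weight I)

-- Length of the binary representation (one digit for 0).
bits : ℕ → ℕ
bits x = suc ⌊log₂ x ⌋

size : ∀ {m} → Instance m → ℕ
size I = bits (n I) + sum λ j →
  bits (due I j) + bits (weight I j) + sum λ i → bits (proc I i j)

------------------------------------------------------------------------
-- Unit-cost random access machines, as structured programs
--
-- A program is a fixed finite text: the names of registers and arrays and
-- all literals are constants, so only array indices are computed.  There is
-- no multiplication: it would let numbers of exponential length be produced
-- in polynomially many unit-cost steps, so that step counts would no longer
-- reflect tractability.

infixl 6 _⊕_ _⊖_
infix  4 _≺_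
infix  3 _≔_ _⟦_⟧≔_
infixr 2 _⨾_

data Expr : Set where
  lit     : ℕ → Expr
  reg     : ℕ → Expr
  _⟦_⟧    : ℕ → Expr → Expr
  _⊕_ _⊖_ : Expr → Expr → Expr    -- addition, truncated subtraction

data Test : Set where
  _≺_ : Expr → Expr → Test

data Program : Set where
  skip           : Program
  _≔_            : ℕ → Expr → Program
  _⟦_⟧≔_         : ℕ → Expr → Expr → Program
  _⨾_            : Program → Program → Program
  ifᵖ_then_else_ : Test → Program → Program → Program
  while_loop_    : Test → Program → Program

record State : Set where
  constructor ⟨_∣_⟩
  field
    regs   : ℕ → ℕ
    arrays : ℕ → ℕ → ℕ

open State public

_[_↦_] : ∀ {A : Set} → (ℕ → A) → ℕ → A → ℕ → A
(f [ x ↦ v ]) y = if y ≡ᵇ x then v else f y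

eval : Expr → State → ℕ
eval (lit c)   σ = c
eval (reg x)   σ = regs σ x
eval (a ⟦ e ⟧) σ = arrays σ a (eval e σ)
eval (e ⊕ e′)  σ = eval e σ + eval e′ σ
eval (e ⊖ e′)  σ = eval e σ ∸ eval e′ σ

test : Test → State → Bool
test (e ≺ e′) σ = eval e σ <ᵇ eval e′ σ

cost : Expr → ℕ
cost (lit c)   = 1
cost (reg x)   = 1
cost (a ⟦ e ⟧) = 1 + cost e
cost (e ⊕ e′)  = 1 + cost e + cost e′
cost (e ⊖ e′)  = 1 + cost e + cost e′

testCost : Test → ℕ
testCost (e ≺ e′) = 1 + cost e + cost e′

-- ⟨ P , σ ⟩⇓⟨ σ′ , t ⟩: started in σ, P halts in σ′ after exactly t steps.
-- At most one rule with one outcome applies to any P and σ.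
data ⟨_,_⟩⇓⟨_,_⟩ : Program → State → State → ℕ → Set where
  skip : ∀ {σ} → ⟨ skip , σ ⟩⇓⟨ σ , 1 ⟩

  assign : ∀ {σ x e} →
    ⟨ x ≔ e , σ ⟩⇓⟨ ⟨ regs σ [ x ↦ eval e σ ] ∣ arrays σ ⟩ , 1 + cost e ⟩

  store : ∀ {σ a e e′} →
    ⟨ a ⟦ e ⟧≔ e′ , σ ⟩⇓⟨
      ⟨ regs σ ∣ arrays σ [ a ↦ arrays σ a [ eval e σ ↦ eval e′ σ ] ] ⟩ ,
      1 + cost e + cost e′ ⟩

  seq : ∀ {P Q σ σ′ σ″ t t′} →
    ⟨ P , σ ⟩⇓⟨ σ′ , t ⟩ → ⟨ Q , σ′ ⟩⇓⟨ σ″ , t′ ⟩ →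
    ⟨ P ⨾ Q , σ ⟩⇓⟨ σ″ , t + t′ ⟩

  ifTrue : ∀ {b P Q σ σ′ t} → test b σ ≡ true →
    ⟨ P , σ ⟩⇓⟨ σ′ , t ⟩ →
    ⟨ ifᵖ b then P else Q , σ ⟩⇓⟨ σ′ , testCost b + t ⟩

  ifFalse : ∀ {b P Q σ σ′ t} → test b σ ≡ false →
    ⟨ Q , σ ⟩⇓⟨ σ′ , t ⟩ →
    ⟨ ifᵖ b then P else Q , σ ⟩⇓⟨ σ′ , testCost b + t ⟩

  whileTrue : ∀ {b P σ σ′ σ″ t t′} → test b σ ≡ true →
    ⟨ P , σ ⟩⇓⟨ σ′ , t ⟩ →
    ⟨ while b loop P , σ′ ⟩⇓⟨ σ″ , t′ ⟩ →
    ⟨ while b loop P , σ ⟩⇓⟨ σ″ , testCost b + t + t′ ⟩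

  whileFalse : ∀ {b P σ} → test b σ ≡ false →
    ⟨ while b loop P , σ ⟩⇓⟨ σ , testCost b ⟩

------------------------------------------------------------------------
-- Problems, running time, fixed-parameter tractability

record Problem : Set₁ where
  field
    Input  : Set
    length : Input → ℕ
    encode : Input → State
    Solved : Input → State → Set

-- P solves every input x in at most T x steps.
SolvesIn : (Π : Problem) → Program → (Problem.Input Π → ℕ) → Set
SolvesIn Π P T = ∀ x → ∃₂ λ σ t →
  ⟨ P , encode x ⟩⇓⟨ σ , t ⟩ × Solved x σ × t ≤ T x
  where open Problem Π

-- Argument and result are held in register 0; all else is initially 0.
Computable : (ℕ → ℕ) → Set
Computable f = ∃ λ P → ∀ x → ∃₂ λ σ t →
  ⟨ P , ⟨ (λ _ → 0) [ 0 ↦ x ] ∣ (λ _ _ → 0) ⟩ ⟩⇓⟨ σ , t ⟩ × regs σ 0 ≡ f x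

FPT : (Π : Problem) → (Problem.Input Π → ℕ) → Set
FPT Π κ = ∃₂ λ P f → ∃ λ c →
  Computable f × SolvesIn Π P (λ x → f (κ x) * length x ^ c)
  where open Problem Π

------------------------------------------------------------------------
-- The problem Fₘ || ∑_{Jⱼ ∈ E} wⱼ

-- The finite vector f followed by infinitely many copies of a.
pad : ∀ {A : Set} {n} → A → Vector A n → ℕ → A
pad {n = zero}  a f x       = a
pad {n = suc n} a f zero    = f zero
pad {n = suc n} a f (suc x) = pad a (λ i → f (suc i)) x

-- Initially register 0 holds n, array 1 the due dates, array 2 the weights
-- and array 3 + i the processing times on machine i; all else is 0.
encodeInstance : ∀ {m} → Instance m → State
encodeInstance I =
  ⟨ (λ _ → 0) [ 0 ↦ n I ]
  ∣ pad (λ _ → 0) (λ a → pad 0 (table a))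
  ⟩
  where table = (λ _ → 0) ∷ due I ∷ weight I ∷ proc I

-- The output E is read off array 0: job j is in E iff its entry is nonzero.
outputSet : ∀ {m} (I : Instance m) → State → Subset (n I)
outputSet I σ = tabulate λ j → 0 <ᵇ arrays σ 0 (toℕ j)

JITFlowShop : ℕ → Problem
JITFlowShop m = record
  { Input  = Instance m
  ; length = size
  ; encode = encodeInstance
  ; Solved = λ I σ → Optimal I (outputSet I σ)
  }

{-# OPTIONS --safe #-}

-- The second machine completes at most one job per due date, and completing the
-- accepted jobs just in time turns their starting times there into deadlines for
-- the first machine, ordered like the due dates.  So a set of jobs is feasible
-- iff, taken in order of due dates, the jobs do not overlap on the second machine
-- and meet these deadlines when the first machine runs them without idle time.
--
-- The algorithm keeps a table of partial solutions, each summarised by its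
-- completion time on the first machine, its last due date and its weight, with
-- a link to the solution it extends.  It visits the classes of jobs with equal
-- due date and weight in lexicographic order and extends each solution in the
-- table by the fitting job of the class that is shortest on the first machine;
-- no other job of the class can do better.  A class at most doubles the table,
-- and there are at most #d · #w classes.
module Submission where

open import Defs
open import Data.Bool.Base using (true; false; if_then_else_; _∧_)
open import Data.Bool.Properties using (T-≡)
import Data.Fin.Base as Fin
open Fin using (Fin; toℕ; fromℕ<)
import Data.Fin.Properties as Fin
open import Data.Fin.Subset using (Subset) renaming (_∈_ to _∈ˢ_)
open import Data.Fin.Subset.Properties using (_∈?_)
import Data.Integer.Base as ℤ
import Data.Integer.Properties as ℤ
open import Data.List.Base
  using (List; []; _∷_; length; filter; map; tabulate; deduplicate; cartesianProduct)
open import Data.List.Membership.Propositional using (_∈_)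
open import Data.List.Membership.Propositional.Properties
  using (∈-cartesianProduct⁺; ∈-deduplicate⁺; ∈-tabulate⁺)
open import Data.List.Properties using (length-++; length-map; length-filter)
open import Data.List.Relation.Binary.Permutation.Propositional
  using (_↭_; prep; swap; ↭-refl; ↭-trans; ↭⇒↭ₛ)
open import Data.List.Relation.Binary.Permutation.Propositional.Properties
  using (All-resp-↭; ↭-length; map⁺)
import Data.List.Relation.Binary.Permutation.Setoid.Properties as Permutation
open import Data.List.Relation.Unary.All as All using (All; []; _∷_)
open import Data.List.Relation.Unary.AllPairs using (AllPairs; []; _∷_)
open import Data.List.Relation.Unary.Any using (here; there)
open import Data.Nat.Base
import Data.Nat.ListAction as List
open import Data.Nat.ListAction.Properties using (sum-↭)
open import Data.Nat.Properties
open import Data.Nat.Tactic.RingSolver using (solve-∀)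
open import Data.Product.Base using (∃; ∃₂; _×_; _,_; proj₁; proj₂; uncurry)
import Data.Rational.Base as ℚ
open ℚ using (ℚ; 0ℚ)
import Data.Rational.Properties as ℚ
import Data.Rational.Unnormalised.Base as ℚᵘ
import Data.Rational.Unnormalised.Properties as ℚᵘ
open import Data.Sum.Base using (_⊎_; inj₁; inj₂; [_,_]′) renaming (map to map-⊎)
open import Data.Unit.Base using (⊤; tt)
open import Data.Vec.Base using (lookup)
open import Data.Vec.Properties using ([]=⇒lookup; lookup⇒[]=; lookup∘tabulate)
open import Function.Base using (_∘_; id; case_of_)
open import Function.Bundles using (module Equivalence)
open import Relation.Binary.Definitions using (tri<; tri≈; tri>)
open import Relation.Binary.PropositionalEquality
open import Relation.Nullary using (¬_; Dec; yes; no; contradiction)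
open import Relation.Nullary.Decidable using (_⊎-dec_; _×-dec_)
open import Relation.Unary using (Decidable)
open import Algebra.Properties.Monoid.Sum +-0-monoid
  using (sum; sum-cong-≗; sum-replicate-zero)

-- Total correctness of programs with time bounds

module Execution where

  -- A Hoare triple for total correctness. `T` is only an upper bound on the exact step count, so
  -- that branches of different lengths can share one bound.
  Ends : Program → State → (State → Set) → ℕ → Set
  Ends P σ Q T = ∃₂ λ σ′ t → ⟨ P , σ ⟩⇓⟨ σ′ , t ⟩ × Q σ′ × t ≤ T

  _[_:=_] : State → ℕ → ℕ → State
  σ [ x := v ] = ⟨ regs σ [ x ↦ v ] ∣ arrays σ ⟩

  _[_at_:=_] : State → ℕ → ℕ → ℕ → State
  σ [ a at i := v ] = ⟨ regs σ ∣ arrays σ [ a ↦ arrays σ a [ i ↦ v ] ] ⟩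

  private variable
    P P′ : Program
    σ : State
    Q R : State → Set
    t t′ u x a : ℕ
    e e′ : Expr

  weaken : (∀ {σ} → Q σ → R σ) → t ≤ u → Ends P σ Q t → Ends P σ R u
  weaken f t≤u (_ , _ , r , q , s≤t) = _ , _ , r , f q , ≤-trans s≤t t≤u

  assign-ends : Q (σ [ x := eval e σ ]) → Ends (x ≔ e) σ Q (1 + cost e)
  assign-ends q = _ , _ , assign , q , ≤-refl

  store-ends : Q (σ [ a at eval e σ := eval e′ σ ]) →
               Ends (a ⟦ e ⟧≔ e′) σ Q (1 + cost e + cost e′)
  store-ends q = _ , _ , store , q , ≤-refl

  seq-ends : Ends P σ R t → (∀ {σ′} → R σ′ → Ends P′ σ′ Q t′) →
             Ends (P ⨾ P′) σ Q (t + t′)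
  seq-ends (_ , _ , r , q , s≤t) f with f q
  ... | _ , _ , r′ , q′ , s′≤t′ = _ , _ , seq r r′ , q′ , +-mono-≤ s≤t s′≤t′

  -- Taking the singleton of the updated state as intermediate assertion turns a proof about
  -- straight-line code into symbolic execution.
  assign-seq : Ends P (σ [ x := eval e σ ]) Q t →
               Ends (x ≔ e ⨾ P) σ Q (1 + cost e + t)
  assign-seq {σ = σ} {x = x} {e = e} h =
    seq-ends {R = _≡ σ [ x := eval e σ ]} (assign-ends refl) λ { refl → h }

  store-seq : Ends P (σ [ a at eval e σ := eval e′ σ ]) Q t →
              Ends (a ⟦ e ⟧≔ e′ ⨾ P) σ Q (1 + cost e + cost e′ + t)
  store-seq {σ = σ} {a = a} {e = e} {e′ = e′} h =
    seq-ends {R = _≡ σ [ a at eval e σ := eval e′ σ ]} (store-ends refl) λ { refl → h }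

  infix  5 _≤ᶠ_
  infixr 4 _∧ᶠ_
  infixr 4 _∨ᶠ_
  infix  3 _⊨_

  -- The machine tests one strict comparison at a time. Compiling a compound condition into a single
  -- expression avoids nested conditionals with duplicated branches.
  data Formula : Set where
    _≤ᶠ_      : Expr → Expr → Formula
    _∧ᶠ_ _∨ᶠ_ : Formula → Formula → Formula

  _⊨_ : State → Formula → Set
  σ ⊨ e ≤ᶠ e′ = eval e σ ≤ eval e′ σ
  σ ⊨ F ∧ᶠ G  = σ ⊨ F × σ ⊨ G
  σ ⊨ F ∨ᶠ G  = σ ⊨ F ⊎ σ ⊨ G

  -- Zero encodes truth; x ∸ (x ∸ y) is the minimum of x and y.
  defect : Formula → Expr
  defect (e ≤ᶠ e′) = e ⊖ e′
  defect (F ∧ᶠ G)  = defect F ⊕ defect G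
  defect (F ∨ᶠ G)  = defect F ⊖ (defect F ⊖ defect G)

  holds : Formula → Test
  holds F = defect F ≺ lit 1

  defect-sound : ∀ F → eval (defect F) σ ≡ 0 → σ ⊨ F
  defect-sound (e ≤ᶠ e′) eq = m∸n≡0⇒m≤n eq
  defect-sound (F ∧ᶠ G)  eq =
    defect-sound F (m+n≡0⇒m≡0 _ eq) , defect-sound G (m+n≡0⇒n≡0 _ eq)
  defect-sound {σ} (F ∨ᶠ G) eq
    with eval (defect F) σ in eqF | eval (defect G) σ in eqG
  ... | zero  | _     = inj₁ (defect-sound F eqF)
  ... | suc _ | zero  = inj₂ (defect-sound G eqG)
  -- If both defects were positive, a vanishing minimum would give `suc x ≤ x ∸ y`.
  ... | suc x | suc y = contradiction (m∸n≡0⇒m≤n eq) (≤⇒≯ (m∸n≤m x y))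

  defect-complete : ∀ F → σ ⊨ F → eval (defect F) σ ≡ 0
  defect-complete (e ≤ᶠ e′) h = m≤n⇒m∸n≡0 h
  defect-complete (F ∧ᶠ G) (h , h′) =
    cong₂ _+_ (defect-complete F h) (defect-complete G h′)
  defect-complete {σ} (F ∨ᶠ G) (inj₁ h)
    rewrite defect-complete {σ} F h = 0∸n≡0 (0 ∸ eval (defect G) σ)
  defect-complete {σ} (F ∨ᶠ G) (inj₂ h)
    rewrite defect-complete {σ} G h = n∸n≡0 (eval (defect F) σ)

  -- The bounds of the two branches are added: this costs at most a constant factor over their
  -- maximum and keeps time bounds polynomial expressions.
  if-ends : ∀ F → (σ ⊨ F → Ends P σ Q t) → (¬ (σ ⊨ F) → Ends P′ σ Q t′) →
            Ends (ifᵖ holds F then P else P′) σ Q (testCost (holds F) + (t + t′))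
  if-ends {σ = σ} {t = t} {t′ = t′} F yes-branch no-branch with eval (defect F) σ in eq
  ... | zero with yes-branch (defect-sound F eq)
  ...   | _ , _ , r , q , s≤t = _ , _ , ifTrue (cong (_<ᵇ 1) eq) r , q ,
          +-monoʳ-≤ (testCost (holds F)) (≤-trans s≤t (m≤m+n _ _))
  if-ends {σ = σ} {t = t} {t′ = t′} F yes-branch no-branch | suc x
    with no-branch (λ h → contradiction (trans (sym eq) (defect-complete F h)) λ ())
  ...   | _ , _ , r , q , s≤t = _ , _ , ifFalse (cong (_<ᵇ 1) eq) r , q ,
          +-monoʳ-≤ (testCost (holds F)) (≤-trans s≤t (m≤n+m _ _))

  <⇒<ᵇ≡true : ∀ {m n} → m < n → (m <ᵇ n) ≡ true
  <⇒<ᵇ≡true {m} {n} lt with m <ᵇ n | <⇒<ᵇ lt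
  ... | true | _ = refl

  ≮⇒<ᵇ≡false : ∀ {m n} → ¬ m < n → (m <ᵇ n) ≡ false
  ≮⇒<ᵇ≡false {m} {n} ≮ with m <ᵇ n in eq
  ... | false = refl
  ... | true  = contradiction (<ᵇ⇒< m n (Equivalence.from T-≡ eq)) ≮

  gap : Expr → Expr → State → ℕ
  gap e e′ σ = eval e′ σ ∸ eval e σ

  -- The truncated difference of the two sides of the test is the variant: it is positive exactly
  -- while the test succeeds, so `k` bounds the number of rounds. The last summand pays for the
  -- failing test.
  while-ends : (Inv : State → Set) →
    (∀ {σ} → Inv σ → eval e σ < eval e′ σ →
      Ends P σ (λ σ′ → Inv σ′ × gap e e′ σ′ < gap e e′ σ) t) →
    ∀ k → Inv σ → gap e e′ σ ≤ k →
    Ends (while (e ≺ e′) loop P) σ (λ σ′ → Inv σ′ × eval e′ σ′ ≤ eval e σ′)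
      (k * (testCost (e ≺ e′) + t) + testCost (e ≺ e′))
  while-ends {e = e} {e′ = e′} {σ = σ} Inv body k inv gap≤k
    with eval e σ <? eval e′ σ
  ... | no ≮ = _ , _ , whileFalse (≮⇒<ᵇ≡false ≮) , (inv , ≮⇒≥ ≮) , m≤n+m _ _
  ... | yes lt with body inv lt
  while-ends Inv body zero inv gap≤k | yes lt | _ =
    contradiction (m∸n≡0⇒m≤n (n≤0⇒n≡0 gap≤k)) (<⇒≱ lt)
  while-ends {e = e} {e′ = e′} {t = t} Inv body (suc k) inv gap≤k
    | yes lt | σ₁ , t₁ , r , (inv′ , shrinks) , t₁≤t
    with while-ends Inv body k inv′ (s≤s⁻¹ (≤-trans shrinks gap≤k))
  ... | _ , _ , r′ , q , t₂≤ =
    _ , _ , whileTrue (<⇒<ᵇ≡true lt) r r′ , q ,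
    ≤-trans (+-mono-≤ (+-monoʳ-≤ (testCost (e ≺ e′)) t₁≤t) t₂≤)
      (≤-reflexive (sym (+-assoc (testCost (e ≺ e′) + t) _ _)))

open Execution

-- Partial solutions

update-same : ∀ (f : ℕ → ℕ) i {v} → (f [ i ↦ v ]) i ≡ v
update-same f i with i ≡ᵇ i | ≡⇒≡ᵇ i i refl
... | true | _ = refl

update-other : ∀ (f : ℕ → ℕ) {i j v} → j ≢ i → (f [ i ↦ v ]) j ≡ f j
update-other f {i} {j} j≢i with j ≡ᵇ i | ≡ᵇ⇒≡ j i
... | true  | eq = contradiction (eq tt) j≢i
... | false | _  = refl

update-below : ∀ (f : ℕ → ℕ) {i j v} → j < i → (f [ i ↦ v ]) j ≡ f j
update-below f = update-other f ∘ <⇒≢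

-- The lexicographic order. With `x ≤ x′` in place of an equation it consists of inequalities only
-- and is what `beforeᶠ` unfolds to under `_⊨_`.
Before : ℕ → ℕ → ℕ → ℕ → Set
Before x y x′ y′ = x < x′ ⊎ (x ≤ x′ × y < y′)

before? : ∀ x y x′ y′ → Dec (Before x y x′ y′)
before? x y x′ y′ = (x <? x′) ⊎-dec ((x ≤? x′) ×-dec (y <? y′))

before-irrefl : ∀ {x y} → ¬ Before x y x y
before-irrefl (inj₁ lt)       = <-irrefl refl lt
before-irrefl (inj₂ (_ , lt)) = <-irrefl refl lt

before-trans : ∀ {x y x′ y′ x″ y″} → Before x y x′ y′ → Before x′ y′ x″ y″ →
               Before x y x″ y″
before-trans (inj₁ h)       (inj₁ k)       = inj₁ (<-trans h k)
before-trans (inj₁ h)       (inj₂ (k , _)) = inj₁ (<-≤-trans h k)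
before-trans (inj₂ (h , _)) (inj₁ k)       = inj₁ (≤-<-trans h k)
before-trans (inj₂ (h , l)) (inj₂ (k , m)) = inj₂ (≤-trans h k , <-trans l m)

before-connex : ∀ {x y x′ y′} → ¬ Before x y x′ y′ → ¬ Before x′ y′ x y →
                x ≡ x′ × y ≡ y′
before-connex h k
  with ≤-antisym (≮⇒≥ (k ∘ inj₁)) (≮⇒≥ (h ∘ inj₁))
... | refl = refl ,
  ≤-antisym (≮⇒≥ λ lt → k (inj₂ (≤-refl , lt))) (≮⇒≥ λ lt → h (inj₂ (≤-refl , lt)))

record Table : Set where
  constructor table
  field
    time last value parent job : ℕ → ℕ

open Table public

-- Entry 0 is the empty solution. Parents precede their children, so following the links ends there
-- and the index can serve as the variant of `output`.
data Trace (T : Table) : ℕ → List ℕ → Set where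
  root : Trace T 0 []
  step : ∀ {s js} → parent T s < s → Trace T (parent T s) js →
         Trace T s (job T s ∷ js)

module Jobs (n : ℕ) (d w p q : ℕ → ℕ) where

  -- c, l and v are the completion time on the first machine, the last due
  -- date and the weight of the jobs in the list, latest job first.
  data Chain : (c l v : ℕ) → List ℕ → Set where
    []    : Chain 0 0 0 []
    extend : ∀ {c l v js j} → Chain c l v js → j < n →
             l + q j ≤ d j → c + p j + q j ≤ d j →
             Chain (c + p j) (d j) (v + w j) (j ∷ js)

  append : Table → ℕ → ℕ → ℕ → Table
  append T N s j = table
    (time T [ N ↦ time T s + p j ]) (last T [ N ↦ d j ])
    (value T [ N ↦ value T s + w j ]) (parent T [ N ↦ s ]) (job T [ N ↦ j ])

  Valid : Table → ℕ → Set
  Valid T N = ∀ s → s < N →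
    ∃ λ js → Trace T s js × Chain (time T s) (last T s) (value T s) js

  -- Equations are split into inequalities so that, joined with `p j < m`, this is what the formula
  -- `fits` unfolds to.
  Fits : ℕ → ℕ → (c l : ℕ) → ℕ → Set
  Fits x y c l j = d j ≤ x × x ≤ d j × w j ≤ y × y ≤ w j ×
                   l + q j ≤ d j × c + p j + q j ≤ d j

  -- An entry that is no later on either machine and no lighter admits every continuation, with no
  -- smaller total weight.
  Dominated : Table → ℕ → (c l v : ℕ) → Set
  Dominated T N c l v =
    ∃ λ r → r < N × time T r ≤ c × last T r ≤ l × v ≤ value T r

  -- Only the head is inspected because it has the latest due date of a chain.
  UpTo : ℕ → ℕ → List ℕ → Set
  UpTo x y []       = ⊤
  UpTo x y (j ∷ js) = ¬ Before x y (d j) (w j)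

  Covers : Table → ℕ → ℕ → ℕ → Set
  Covers T N x y = ∀ {c l v js} → Chain c l v js → UpTo x y js →
                   Dominated T N c l v

  Extended : Table → ℕ → ℕ → ℕ → ℕ → Set
  Extended T N x y s = ∀ {j} → j < n → Fits x y (time T s) (last T s) j →
    Dominated T N (time T s + p j) (d j) (value T s + w j)

  module _ {T : Table} {N s j : ℕ} where
    private T′ = append T N s j

    trace-append : ∀ {r js} → r < N → Trace T r js → Trace T′ r js
    trace-append r<N root = root
    trace-append {r} r<N (step {js = js} lt tr) =
      subst (λ i → Trace T′ r (i ∷ js)) (update-below (job T) r<N)
        (step (subst (_< r) (sym eq) lt)
          (subst (λ i → Trace T′ i js) (sym eq)
            (trace-append (<-trans lt r<N) tr)))
      where eq = update-below (parent T) r<N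

    valid-append : Valid T N → s < N → j < n →
                   last T s + q j ≤ d j → time T s + p j + q j ≤ d j →
                   Valid T′ (suc N)
    valid-append valid s<N j<n h h′ r r<1+N with m≤n⇒m<n∨m≡n (s≤s⁻¹ r<1+N)
    ... | inj₁ r<N with valid r r<N
    ...   | js , tr , ch
      rewrite update-below (time T) {v = time T s + p j} r<N
            | update-below (last T) {v = d j} r<N
            | update-below (value T) {v = value T s + w j} r<N
      = js , trace-append r<N tr , ch
    valid-append valid s<N j<n h h′ r r<1+N | inj₂ refl with valid s s<N
    ...   | js , tr , ch
      rewrite update-same (time T) N {time T s + p j}
            | update-same (last T) N {d j}
            | update-same (value T) N {value T s + w j}
      = j ∷ js ,
        subst (λ i → Trace T′ N (i ∷ js)) (update-same (job T) N)
          (step (subst (_< N) (sym eq) s<N)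
            (subst (λ i → Trace T′ i js) (sym eq) (trace-append s<N tr))) ,
        extend ch j<n h h′
      where eq = update-same (parent T) N {s}

    dominated-append : ∀ {M c l v} → M ≤ N → Dominated T M c l v →
                       Dominated T′ M c l v
    dominated-append M≤N (r , r<M , h , h′ , h″) =
      r , r<M ,
      ≤-trans (≤-reflexive (update-below (time T) r<N)) h ,
      ≤-trans (≤-reflexive (update-below (last T) r<N)) h′ ,
      ≤-trans h″ (≤-reflexive (sym (update-below (value T) r<N)))
      where r<N = <-≤-trans r<M M≤N

    dominated-new : ∀ {c l v} → time T s + p j ≤ c → d j ≤ l →
                    v ≤ value T s + w j → Dominated T′ (suc N) c l v
    dominated-new h h′ h″ =
      N , n<1+n N ,
      ≤-trans (≤-reflexive (update-same (time T) N)) h ,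
      ≤-trans (≤-reflexive (update-same (last T) N)) h′ ,
      ≤-trans h″ (≤-reflexive (sym (update-same (value T) N)))

    covers-append : ∀ {M x y} → M ≤ N → Covers T M x y → Covers T′ M x y
    covers-append M≤N cov ch h = dominated-append M≤N (cov ch h)

    extended-append : ∀ {x y r} → r < N → Extended T N x y r →
                      Extended T′ (suc N) x y r
    extended-append r<N ext i<n fits
      rewrite update-below (time T) {v = time T s + p j} r<N
            | update-below (last T) {v = d j} r<N
            | update-below (value T) {v = value T s + w j} r<N
      with dominated-append ≤-refl (ext i<n fits)
    ... | r , r<N , h = r , m<n⇒m<1+n r<N , h

    -- Fitting jobs of one class agree in due date and weight, and the second processing time leaves
    -- no trace in the entry, so the first processing time alone decides dominance.
    extended-new : ∀ {x y} → s < N → x ≡ d j → y ≡ w j →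
      (∀ {i} → i < n → Fits x y (time T s) (last T s) i → p j ≤ p i) →
      Extended T′ (suc N) x y s
    extended-new s<N refl refl least i<n fits
      rewrite update-below (time T) {v = time T s + p j} s<N
            | update-below (last T) {v = d j} s<N
            | update-below (value T) {v = value T s + w j} s<N
      = dominated-new (+-monoʳ-≤ (time T s) (least i<n fits)) (proj₁ (proj₂ fits))
          (+-monoʳ-≤ (value T s) (proj₁ (proj₂ (proj₂ fits))))

  dominated-≤ : ∀ {T M N c l v} → M ≤ N → Dominated T M c l v → Dominated T N c l v
  dominated-≤ M≤N (r , r<M , h) = r , <-≤-trans r<M M≤N , h

  module _ (q>0 : ∀ {j} → j < n → 0 < q j) where

    -- A chain whose last job lies in the class (x′ , y′) extends one that ends
    -- before that class, because due dates increase strictly along a chain.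
    covers-next : ∀ {T E N x y x′ y′} → E ≤ N → Covers T E x y →
      (∀ {s} → s < E → Extended T N x′ y′ s) →
      (∀ {i} → i < n → Before x y (d i) (w i) → ¬ Before (d i) (w i) x′ y′) →
      Covers T N x′ y′
    covers-next {T} E≤N cov ext least [] _ = dominated-≤ {T} E≤N (cov [] tt)
    covers-next {T} {x = x} {y} {x′} {y′} E≤N cov ext least {js = j ∷ js}
      ch@(extend {c = c} {l} {v} ch′ j<n h h′) ¬after
      with before? x y (d j) (w j)
    ... | no ¬b = dominated-≤ {T} E≤N (cov ch ¬b)
    -- The class of `j` lies after `(x , y)`, hence not before `(x′ , y′)`, and also not after it,
    -- so it is `(x′ , y′)`.
    ... | yes b with before-connex (least j<n b) ¬after
    ... | refl , refl with cov ch′ (earlier ch′ (≤-trans (m<m+n l (q>0 j<n)) h))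
      where
      earlier : ∀ {c l v js} → Chain c l v js → l < x′ → UpTo x y js
      earlier []               _  = tt
      earlier (extend _ i<n _ _) lt b = least i<n b (inj₁ lt)
    -- Entry `s` dominates the rest of the chain, so `j` fits behind `s` as well, and the entry made
    -- for `s` dominates the whole chain.
    ... | s , s<E , c′≤c , l′≤l , v≤v′
      with ext s<E j<n
        ( ≤-refl , ≤-refl , ≤-refl , ≤-refl
        , ≤-trans (+-monoˡ-≤ (q j) l′≤l) h
        , ≤-trans (+-monoˡ-≤ (q j) (+-monoˡ-≤ (p j) c′≤c)) h′ )
    ... | r , r<N , g , g′ , g″ =
      r , r<N , ≤-trans g (+-monoˡ-≤ (p j) c′≤c) , g′ ,
      ≤-trans (+-monoˡ-≤ (w j) v≤v′) g″

module _ {A : Set} {P Q : A → Set} (P? : Decidable P) (Q? : Decidable Q)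
         (P⊆Q : ∀ {x} → P x → Q x) where

  length-filter-mono : ∀ xs → length (filter P? xs) ≤ length (filter Q? xs)
  length-filter-mono [] = z≤n
  length-filter-mono (x ∷ xs) with P? x | Q? x
  ... | yes _  | yes _  = s≤s (length-filter-mono xs)
  ... | yes px | no ¬qx = contradiction (P⊆Q px) ¬qx
  ... | no _   | yes _  = m≤n⇒m≤1+n (length-filter-mono xs)
  ... | no _   | no _   = length-filter-mono xs

  length-filter-strict : ∀ {x xs} → x ∈ xs → ¬ P x → Q x →
                         length (filter P? xs) < length (filter Q? xs)
  length-filter-strict {x} {xs = y ∷ ys} (here refl) ¬px qx with P? x | Q? x
  ... | yes px | _      = contradiction px ¬px
  ... | no _   | no ¬qx = contradiction qx ¬qx
  ... | no _   | yes _  = s≤s (length-filter-mono ys)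
  length-filter-strict {xs = y ∷ ys} (there x∈) ¬px qx with P? y | Q? y
  ... | yes _  | yes _  = s≤s (length-filter-strict x∈ ¬px qx)
  ... | yes py | no ¬qy = contradiction (P⊆Q py) ¬qy
  ... | no _   | yes _  = m<n⇒m<1+n (length-filter-strict x∈ ¬px qx)
  ... | no _   | no _   = length-filter-strict x∈ ¬px qx

-- Feasible sets

-- Comparisons and sums are transferred to unnormalised fractions, whose numerators are not hidden
-- behind a division by a gcd.
toℚᵘ-fromℕ : ∀ x → ℚ.toℚᵘ (fromℕ x) ℚᵘ.≃ ℚᵘ.mkℚᵘ (ℤ.+ x) 0
toℚᵘ-fromℕ x = ℚ.toℚᵘ-fromℚᵘ (ℚᵘ.mkℚᵘ (ℤ.+ x) 0)

fromℕ-mono-≤ : ∀ x y → x ≤ y → fromℕ x ℚ.≤ fromℕ y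
fromℕ-mono-≤ x y x≤y = ℚ.toℚᵘ-cancel-≤
  (ℚᵘ.≤-respˡ-≃ (ℚᵘ.≃-sym (toℚᵘ-fromℕ x))
    (ℚᵘ.≤-respʳ-≃ (ℚᵘ.≃-sym (toℚᵘ-fromℕ y))
      (ℚᵘ.*≤* (ℤ.*-monoʳ-≤-nonNeg (ℤ.+ 1) (ℤ.+≤+ x≤y)))))

fromℕ-mono-< : ∀ x y → x < y → fromℕ x ℚ.< fromℕ y
fromℕ-mono-< x y x<y = ℚ.toℚᵘ-cancel-<
  (ℚᵘ.<-respˡ-≃ (ℚᵘ.≃-sym (toℚᵘ-fromℕ x))
    (ℚᵘ.<-respʳ-≃ (ℚᵘ.≃-sym (toℚᵘ-fromℕ y))
      (ℚᵘ.*<* (ℤ.*-monoʳ-<-pos (ℤ.+ 1) (ℤ.+<+ x<y)))))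

fromℕ-cancel-≤ : ∀ x y → fromℕ x ℚ.≤ fromℕ y → x ≤ y
fromℕ-cancel-≤ x y h = ≮⇒≥ λ lt → ℚ.<-irrefl refl (ℚ.<-≤-trans (fromℕ-mono-< y x lt) h)

fromℕ-+ : ∀ x y → fromℕ (x + y) ≡ fromℕ x ℚ.+ fromℕ y
fromℕ-+ x y = ℚ.toℚᵘ-injective (ℚᵘ.≃-trans (toℚᵘ-fromℕ (x + y))
  (ℚᵘ.≃-sym (ℚᵘ.≃-trans (ℚ.toℚᵘ-homo-+ (fromℕ x) (fromℕ y))
    (ℚᵘ.≃-trans (ℚᵘ.+-cong (toℚᵘ-fromℕ x) (toℚᵘ-fromℕ y))
      (ℚᵘ.*≡* (cong (ℤ._* ℤ.+ 1) (trans
        (cong₂ ℤ._+_ (ℤ.*-identityʳ (ℤ.+ x)) (ℤ.*-identityʳ (ℤ.+ y))) refl)))))))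

0≤fromℕ : ∀ x → 0ℚ ℚ.≤ fromℕ x
0≤fromℕ x = fromℕ-mono-≤ 0 x z≤n

fromℕ-≤-+ : ∀ x y z → x + y ≤ z → fromℕ x ℚ.+ fromℕ y ℚ.≤ fromℕ z
fromℕ-≤-+ x y z h = subst (ℚ._≤ fromℕ z) (fromℕ-+ x y) (fromℕ-mono-≤ (x + y) z h)

+-positive-≰ : ∀ a x → 0 < x → ¬ a ℚ.+ fromℕ x ℚ.≤ a
+-positive-≰ a x 0<x h = ℚ.<-irrefl refl (ℚ.<-≤-trans
  (subst (ℚ._< a ℚ.+ fromℕ x) (ℚ.+-identityʳ a) (ℚ.+-monoʳ-< a (fromℕ-mono-< 0 x 0<x))) h)

module Intervals {A : Set} (start : A → ℚ) (len : A → ℕ) (len>0 : ∀ x → 0 < len x) where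

  end : A → ℚ
  end x = start x ℚ.+ fromℕ (len x)

  Disjoint : A → A → Set
  Disjoint x y = end x ℚ.≤ start y ⊎ end y ℚ.≤ start x

  latest : ∀ x xs → ∃₂ λ y ys → x ∷ xs ↭ y ∷ ys × All (λ z → start z ℚ.≤ start y) ys
  latest x [] = x , [] , ↭-refl , []
  latest x (x′ ∷ xs) with latest x′ xs
  ... | y , ys , perm , max with ℚ.≤-total (start x) (start y)
  ...   | inj₁ x≤y = y , x ∷ ys , ↭-trans (prep x perm) (swap x y ↭-refl) , x≤y ∷ max
  ...   | inj₂ y≤x = x , y ∷ ys , prep x perm , y≤x ∷ All.map (λ z≤y → ℚ.≤-trans z≤y y≤x) max

  -- All other intervals end before the one that starts last, so induction applies to them with its
  -- start as the new `t`. The fuel `k` is there because the remaining list is a permutation rather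
  -- than a structural part.
  total-length : ∀ k xs {t} → length xs ≤ k → AllPairs Disjoint xs →
    All (λ x → 0ℚ ℚ.≤ start x) xs → All (λ x → end x ℚ.≤ t) xs → 0ℚ ℚ.≤ t →
    fromℕ (List.sum (map len xs)) ℚ.≤ t
  total-length k [] _ _ _ _ 0≤t = 0≤t
  total-length (suc k) (x ∷ xs) {t} len≤k disj starts ends _ with latest x xs
  ... | y , ys , perm , max
    with Permutation.AllPairs-resp-↭ (setoid A) [ inj₂ , inj₁ ]′
           ((λ { refl h → h }) , (λ { refl h → h })) (↭⇒↭ₛ perm) disj
       | All-resp-↭ perm starts | All-resp-↭ perm ends
  ... | dis ∷ disj′ | 0≤y ∷ starts′ | y≤t ∷ _ =
    subst (λ m → fromℕ m ℚ.≤ t) (sym (sum-↭ (map⁺ len perm)))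
      (subst (ℚ._≤ t) (trans (sym (fromℕ-+ m (len y))) (cong fromℕ (+-comm m (len y))))
        (ℚ.≤-trans (ℚ.+-monoˡ-≤ (fromℕ (len y)) rest) y≤t))
    where
    m = List.sum (map len ys)

    before : ∀ {zs} → All (Disjoint y) zs → All (λ z → start z ℚ.≤ start y) zs →
             All (λ z → end z ℚ.≤ start y) zs
    before [] [] = []
    -- An interval of positive length cannot end before an interval that starts no later than
    -- itself.
    before (inj₁ y≤z ∷ ds) (z≤y ∷ ms) =
      contradiction (ℚ.≤-trans y≤z z≤y) (+-positive-≰ (start y) (len y) (len>0 y))
    before (inj₂ z≤y ∷ ds) (_ ∷ ms) = z≤y ∷ before ds ms

    rest : fromℕ m ℚ.≤ start y
    rest = total-length k ys
      (s≤s⁻¹ (subst (_≤ suc k) (↭-length perm) len≤k)) disj′ starts′ (before dis max) 0≤y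

sum-split : ∀ {n} (f g : Fin n → ℕ) j → (∀ k → k ≢ j → g k ≡ f k) → g j ≡ 0 →
            sum f ≡ f j + sum g
sum-split {suc n} f g Fin.zero other zeroed rewrite zeroed =
  cong (f Fin.zero +_) (sum-cong-≗ λ k → sym (other (Fin.suc k) λ ()))
sum-split {suc n} f g (Fin.suc j) other zeroed
  rewrite sum-split (f ∘ Fin.suc) (g ∘ Fin.suc) j
            (λ k k≢j → other (Fin.suc k) (k≢j ∘ Fin.suc-injective)) zeroed
        | other Fin.zero (λ ())
  = begin
    f₀ + (fⱼ + g′) ≡⟨ sym (+-assoc f₀ fⱼ g′) ⟩
    f₀ + fⱼ + g′   ≡⟨ cong (_+ g′) (+-comm f₀ fⱼ) ⟩
    fⱼ + f₀ + g′   ≡⟨ +-assoc fⱼ f₀ g′ ⟩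
    fⱼ + (f₀ + g′) ∎
  where
  open ≡-Reasoning
  f₀ = f Fin.zero
  fⱼ = f (Fin.suc j)
  g′ = sum (g ∘ Fin.suc)

without : ∀ {n} → (Fin n → ℕ) → Fin n → Fin n → ℕ
without f j k with k Fin.≟ j
... | yes _ = 0
... | no _  = f k

without-other : ∀ {n} (f : Fin n → ℕ) {j k} → k ≢ j → without f j k ≡ f k
without-other f {j} {k} k≢j with k Fin.≟ j
... | yes eq = contradiction eq k≢j
... | no _   = refl

without-same : ∀ {n} (f : Fin n → ℕ) j → without f j j ≡ 0
without-same f j with j Fin.≟ j
... | yes _ = refl
... | no ≢  = contradiction refl ≢

sum-without : ∀ {n} (f : Fin n → ℕ) j → sum f ≡ f j + sum (without f j)
sum-without f j = sum-split f (without f j) j (λ k → without-other f) (without-same f j)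

pad-toℕ : ∀ {n} {f : Fin n → ℕ} j → pad 0 f (toℕ j) ≡ f j
pad-toℕ Fin.zero    = refl
pad-toℕ (Fin.suc j) = pad-toℕ j

module ChainProperties (n : ℕ) (d w p q : ℕ → ℕ) where
  open Jobs n d w p q

  load : List ℕ → ℕ
  load js = List.sum (map p js)

  -- The latest job comes first in the list, so the jobs processed before `j` form the tail behind
  -- it, and without idle time `j` starts at their load.
  startOf : List ℕ → ℕ → ℕ
  startOf []       i = 0
  startOf (j ∷ js) i with i ≟ j
  ... | yes _ = load js
  ... | no _  = startOf js i

  private variable
    c l v i k : ℕ
    js : List ℕ

  chain-time : Chain c l v js → c ≡ load js
  chain-time [] = refl
  chain-time (extend {c = c} {j = j} ch _ _ _) =
    trans (+-comm c (p j)) (cong (p j +_) (chain-time ch))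

  due≤last : Chain c l v js → i ∈ js → d i ≤ l
  due≤last (extend ch _ _ _) (here refl) = ≤-refl
  due≤last (extend ch _ h _) (there i∈)  =
    ≤-trans (due≤last ch i∈) (m+n≤o⇒m≤o _ h)

  end≤time : Chain c l v js → i ∈ js → startOf js i + p i ≤ c
  end≤time {i = i} (extend {c = c} {j = j} ch _ _ _) i∈ with i ≟ j | i∈
  ... | yes refl | _         = ≤-reflexive (cong (_+ p i) (sym (chain-time ch)))
  ... | no i≢j   | here eq   = contradiction eq i≢j
  ... | no _     | there i∈′ = ≤-trans (end≤time ch i∈′) (m≤m+n c (p j))

  timely : Chain c l v js → i ∈ js → startOf js i + p i + q i ≤ d i
  timely {i = i} (extend {j = j} ch _ _ h) i∈ with i ≟ j | i∈
  ... | yes refl | _ rewrite sym (chain-time ch) = h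
  ... | no i≢j   | here eq   = contradiction eq i≢j
  ... | no _     | there i∈′ = timely ch i∈′

  first-machine : Chain c l v js → i ∈ js → k ∈ js → i ≢ k →
    startOf js i + p i ≤ startOf js k ⊎ startOf js k + p k ≤ startOf js i
  first-machine {i = i} {k} (extend {j = j} ch _ _ _) i∈ k∈ i≢k
    with i ≟ j | k ≟ j | i∈ | k∈
  ... | yes refl | yes refl | _         | _         = contradiction refl i≢k
  ... | yes refl | no k≢j   | _         | here eq   = contradiction eq k≢j
  ... | yes refl | no _     | _         | there k∈′ =
    inj₂ (≤-trans (end≤time ch k∈′) (≤-reflexive (chain-time ch)))
  ... | no i≢j   | _        | here eq   | _         = contradiction eq i≢j
  ... | no _     | yes refl | there i∈′ | _         =
    inj₁ (≤-trans (end≤time ch i∈′) (≤-reflexive (chain-time ch)))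
  ... | no _     | no k≢j   | there _   | here eq   = contradiction eq k≢j
  ... | no _     | no _     | there i∈′ | there k∈′ = first-machine ch i∈′ k∈′ i≢k

  second-machine : Chain c l v js → i ∈ js → k ∈ js → i ≢ k →
    d i + q k ≤ d k ⊎ d k + q i ≤ d i
  second-machine (extend ch _ _ _) (here refl) (here refl) i≢k = contradiction refl i≢k
  second-machine (extend {j = j} ch _ h _) (here refl) (there k∈) _ =
    inj₂ (≤-trans (+-monoˡ-≤ (q j) (due≤last ch k∈)) h)
  second-machine (extend {j = j} ch _ h _) (there i∈) (here refl) _ =
    inj₁ (≤-trans (+-monoˡ-≤ (q j) (due≤last ch i∈)) h)
  second-machine (extend ch _ _ _) (there i∈) (there k∈) i≢k =
    second-machine ch i∈ k∈ i≢k

  -- Due dates increase strictly along a chain, so no job is counted twice. The bound is stated for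
  -- arbitrary `f` so that the entry of the head can be set to zero before the recursive call.
  chain-value : (∀ {j} → j < n → 0 < q j) → Chain c l v js →
    (f : Fin n → ℕ) → (∀ j → toℕ j ∈ js → w (toℕ j) ≤ f j) → v ≤ sum f
  chain-value q>0 [] f _ = z≤n
  chain-value q>0 (extend {l = l} {v} {js} {j} ch j<n h _) f bound = begin
    v + w j                  ≡⟨ +-comm v (w j) ⟩
    w j + v                  ≤⟨ +-mono-≤ (subst (λ k → w k ≤ f jᶠ) jᶠ≡j (bound jᶠ (here jᶠ≡j)))
                                  (chain-value q>0 ch (without f jᶠ) bound′) ⟩
    f jᶠ + sum (without f jᶠ)  ≡⟨ sym (sum-without f jᶠ) ⟩
    sum f                    ∎
    where
    open ≤-Reasoning
    jᶠ = fromℕ< j<n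
    jᶠ≡j = Fin.toℕ-fromℕ< j<n

    j∉js : ¬ j ∈ js
    j∉js j∈ = <⇒≱ (<-≤-trans (m<m+n l (q>0 j<n)) h) (due≤last ch j∈)

    bound′ : ∀ k → toℕ k ∈ js → w (toℕ k) ≤ without f jᶠ k
    bound′ k k∈ = ≤-trans (bound k (there k∈)) (≤-reflexive (sym (without-other f λ eq →
      j∉js (subst (_∈ js) (trans (cong toℕ eq) jᶠ≡j) k∈))))

module Schedules (I : Instance 2) where

  -- Padding with zeros makes these definitionally the arrays that `encodeInstance` supplies.
  d w p q : ℕ → ℕ
  d = pad 0 (due I)
  w = pad 0 (weight I)
  p = pad 0 (proc I Fin.zero)
  q = pad 0 (proc I (Fin.suc Fin.zero))

  M₁ M₂ : Fin 2
  M₁ = Fin.zero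
  M₂ = Fin.suc Fin.zero

  open Jobs (n I) d w p q
  open ChainProperties (n I) d w p q

  q>0 : ∀ {j} → j < n I → 0 < q j
  q>0 j<n rewrite sym (Fin.toℕ-fromℕ< j<n)
                | pad-toℕ {f = proc I M₂} (fromℕ< j<n) = proc>0 I _ _

  d>0 : ∀ {j} → j < n I → 0 < d j
  d>0 j<n rewrite sym (Fin.toℕ-fromℕ< j<n) | pad-toℕ {f = due I} (fromℕ< j<n) = due>0 I _

  module _ {c l v js} (chain : Chain c l v js) (E : Subset (n I)) where

    -- The first machine runs the chain without idle time, and the second starts each job just in
    -- time. By `timely`, the truncated differences are exact and the first operation is completed
    -- before the second starts.
    chain-feasible : (∀ {j} → j ∈ˢ E → toℕ j ∈ js) → Feasible I E
    chain-feasible ⊆js = record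
      { start    = start
      ; released = λ { Fin.zero {j} _ → 0≤fromℕ (startOf js (toℕ j))
                     ; (Fin.suc Fin.zero) {j} _ → 0≤fromℕ (due I j ∸ proc I M₂ j) }
      ; route    = route
      ; capacity = capacity
      ; onTime   = onTime
      }
      where
      start : Fin 2 → Fin (n I) → ℚ
      start Fin.zero    j = fromℕ (startOf js (toℕ j))
      start (Fin.suc _) j = fromℕ (due I j ∸ proc I M₂ j)

      timely′ : ∀ {j} → j ∈ˢ E →
        startOf js (toℕ j) + proc I M₁ j + proc I M₂ j ≤ due I j
      timely′ {j} j∈ with timely chain (⊆js j∈)
      ... | h rewrite pad-toℕ {f = due I} j
                    | pad-toℕ {f = proc I M₁} j
                    | pad-toℕ {f = proc I M₂} j = h

      route : ∀ {i i′ : Fin 2} → toℕ i′ ≡ suc (toℕ i) → ∀ {j} → j ∈ˢ E →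
              start i j ℚ.+ fromℕ (proc I i j) ℚ.≤ start i′ j
      route {Fin.zero} {Fin.suc Fin.zero} _ {j} j∈ =
        fromℕ-≤-+ (startOf js (toℕ j)) (proc I M₁ j) (due I j ∸ proc I M₂ j)
          (m+n≤o⇒m≤o∸n _ (timely′ j∈))
      route {Fin.suc Fin.zero} {Fin.suc Fin.zero} ()

      onTime : ∀ {i : Fin 2} → suc (toℕ i) ≡ 2 → ∀ {j} → j ∈ˢ E →
               start i j ℚ.+ fromℕ (proc I i j) ≡ fromℕ (due I j)
      onTime {Fin.suc Fin.zero} _ {j} j∈ =
        trans (sym (fromℕ-+ (due I j ∸ proc I M₂ j) (proc I M₂ j)))
          (cong fromℕ (m∸n+n≡m (m+n≤o⇒n≤o (startOf js (toℕ j) + proc I M₁ j) (timely′ j∈))))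

      disjoint₁ : ∀ {j k} → j ∈ˢ E → k ∈ˢ E → j ≢ k →
        startOf js (toℕ j) + proc I M₁ j ≤ startOf js (toℕ k) ⊎
        startOf js (toℕ k) + proc I M₁ k ≤ startOf js (toℕ j)
      disjoint₁ {j} {k} j∈ k∈ j≢k
        with first-machine chain (⊆js j∈) (⊆js k∈) (j≢k ∘ Fin.toℕ-injective)
      ... | h rewrite pad-toℕ {f = proc I M₁} j | pad-toℕ {f = proc I M₁} k = h

      disjoint₂ : ∀ {j k} → j ∈ˢ E → k ∈ˢ E → j ≢ k →
        due I j + proc I M₂ k ≤ due I k ⊎ due I k + proc I M₂ j ≤ due I j
      disjoint₂ {j} {k} j∈ k∈ j≢k
        with second-machine chain (⊆js j∈) (⊆js k∈) (j≢k ∘ Fin.toℕ-injective)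
      ... | h rewrite pad-toℕ {f = proc I M₂} j | pad-toℕ {f = proc I M₂} k
                    | pad-toℕ {f = due I} j | pad-toℕ {f = due I} k = h

      due≤start : ∀ {j k} → j ∈ˢ E → due I j + proc I M₂ k ≤ due I k →
                  start M₂ j ℚ.+ fromℕ (proc I M₂ j) ℚ.≤ start M₂ k
      due≤start {j} {k} j∈ h = ℚ.≤-trans (ℚ.≤-reflexive (onTime refl j∈))
        (fromℕ-mono-≤ (due I j) (due I k ∸ proc I M₂ k) (m+n≤o⇒m≤o∸n _ h))

      capacity : ∀ i {j k} → j ∈ˢ E → k ∈ˢ E → j ≢ k →
        start i j ℚ.+ fromℕ (proc I i j) ℚ.≤ start i k ⊎
        start i k ℚ.+ fromℕ (proc I i k) ℚ.≤ start i j
      capacity Fin.zero {j} {k} j∈ k∈ j≢k =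
        map-⊎ (fromℕ-≤-+ (startOf js (toℕ j)) (proc I M₁ j) (startOf js (toℕ k)))
              (fromℕ-≤-+ (startOf js (toℕ k)) (proc I M₁ k) (startOf js (toℕ j)))
              (disjoint₁ j∈ k∈ j≢k)
      capacity (Fin.suc Fin.zero) j∈ k∈ j≢k =
        map-⊎ (due≤start j∈) (due≤start k∈) (disjoint₂ j∈ k∈ j≢k)

    chain-weight : (∀ {j} → toℕ j ∈ js → j ∈ˢ E) → v ≤ totalWeight I E
    chain-weight js⊆ = chain-value q>0 chain _ bound
      where
      bound : ∀ j → toℕ j ∈ js → w (toℕ j) ≤ (if lookup E j then weight I j else 0)
      bound j j∈ rewrite []=⇒lookup (js⊆ j∈) = ≤-reflexive (pad-toℕ j)

  module _ (E : Subset (n I)) (S : JITSchedule I E) where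
    open JITSchedule S

    open Intervals (start M₁) (proc I M₁) (proc>0 I M₁)

    weightBelow : ℕ → Fin (n I) → ℕ
    weightBelow t j = if (due I j <ᵇ t) ∧ lookup E j then weight I j else 0

    -- The opposite order on the second machine would force `due I j ≤ due I h`.
    second-order : ∀ {h j} → h ∈ˢ E → j ∈ˢ E → due I h < due I j →
                   fromℕ (due I h) ℚ.≤ start M₂ j
    second-order {h} {j} h∈ j∈ lt with capacity M₂ h∈ j∈ (λ { refl → <-irrefl refl lt })
    ... | inj₁ le = ℚ.≤-trans (ℚ.≤-reflexive (sym (onTime refl h∈))) le
    ... | inj₂ le = contradiction
      (fromℕ-cancel-≤ (due I j) (due I h) (ℚ.≤-trans (ℚ.≤-reflexive (sym (onTime refl j∈)))
        (ℚ.≤-trans le (ℚ.≤-trans (start≤end h) (ℚ.≤-reflexive (onTime refl h∈))))))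
      (<⇒≱ lt)
      where
      start≤end : ∀ j → start M₂ j ℚ.≤ completion M₂ j
      start≤end j = ℚ.≤-trans (ℚ.≤-reflexive (sym (ℚ.+-identityʳ _)))
        (ℚ.+-monoʳ-≤ (start M₂ j) (0≤fromℕ (proc I M₂ j)))

    -- Two distinct jobs completed at the same instant would overlap on the second machine.
    due-injective : ∀ {h j} → h ∈ˢ E → j ∈ˢ E → due I h ≡ due I j → h ≡ j
    due-injective {h} {j} h∈ j∈ eq with h Fin.≟ j
    ... | yes h≡j = h≡j
    ... | no h≢j = contradiction (capacity M₂ h∈ j∈ h≢j)
      [ clash j h eq (onTime refl h∈) (onTime refl j∈)
      , clash h j (sym eq) (onTime refl j∈) (onTime refl h∈) ]′
      where
      clash : ∀ j h → due I h ≡ due I j → completion M₂ h ≡ fromℕ (due I h) →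
              completion M₂ j ≡ fromℕ (due I j) → ¬ completion M₂ h ℚ.≤ start M₂ j
      clash j h e ch cj le = +-positive-≰ (start M₂ j) (proc I M₂ j) (proc>0 I M₂ j)
        (ℚ.≤-trans (ℚ.≤-reflexive (trans cj (trans (cong fromℕ (sym e)) (sym ch)))) le)

    record ChainBelow (t : ℕ) : Set where
      field
        {c l v} : ℕ
        jobs    : List (Fin (n I))
        chain   : Chain c l v (map toℕ jobs)
        below   : All (λ j → j ∈ˢ E × due I j < t) jobs
        apart   : AllPairs Disjoint jobs
        total   : v ≡ sum (weightBelow t)

    load-toℕ : ∀ js → load (map toℕ js) ≡ List.sum (map (proc I M₁) js)
    load-toℕ []       = refl
    load-toℕ (j ∷ js) = cong₂ _+_ (pad-toℕ j) (load-toℕ js)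

    weightBelow-other : ∀ t j → ¬ (j ∈ˢ E × due I j ≡ t) →
                        weightBelow t j ≡ weightBelow (suc t) j
    weightBelow-other t j h with <-cmp (due I j) t
    ... | tri< lt _ _ rewrite <⇒<ᵇ≡true lt | <⇒<ᵇ≡true (m<n⇒m<1+n lt) = refl
    ... | tri> ≮ _ gt rewrite ≮⇒<ᵇ≡false ≮ | ≮⇒<ᵇ≡false (<⇒≱ gt ∘ s≤s⁻¹) = refl
    ... | tri≈ _ eq _ with lookup E j in eqE
    ...   | true = contradiction (lookup⇒[]= j E eqE , eq) h
    ...   | false with due I j <ᵇ t | due I j <ᵇ suc t
    ...     | true  | true  = refl
    ...     | true  | false = refl
    ...     | false | true  = refl
    ...     | false | false = refl

    -- Induction over all possible due dates: by `due-injective` at most one job of `E` is due at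
    -- `t`, and it becomes the new head of the chain.
    chain-below : ∀ t → ChainBelow t
    chain-below zero = record
      { jobs = [] ; chain = [] ; below = [] ; apart = []
      ; total = sym (sum-replicate-zero (n I)) }
    chain-below (suc t) with chain-below t | Fin.any? (λ j → j ∈? E ×-dec due I j ≟ t)
    ... | cb | no none = record
      { jobs = jobs ; chain = chain ; apart = apart
      ; below = All.map (λ { (j∈ , lt) → j∈ , m<n⇒m<1+n lt }) below
      ; total = trans total (sum-cong-≗ λ j → weightBelow-other t j λ h → none (j , h)) }
      where open ChainBelow cb
    ... | cb | yes (j , j∈ , refl) = record
      { jobs  = j ∷ jobs
      ; chain = extend chain (Fin.toℕ<n j) last≤ time≤
      ; below = (j∈ , ≤-refl) ∷ All.map (λ { (i∈ , lt) → i∈ , m<n⇒m<1+n lt }) below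
      ; apart = All.map (λ { (i∈ , lt) → capacity M₁ j∈ i∈ λ { refl → <-irrefl refl lt } })
                  below ∷ apart
      ; total = value′
      }
      where
      open ChainBelow cb

      start+q≤due : ∀ x → fromℕ x ℚ.≤ start M₂ j → x + q (toℕ j) ≤ d (toℕ j)
      start+q≤due x le rewrite pad-toℕ {f = due I} j | pad-toℕ {f = proc I M₂} j =
        fromℕ-cancel-≤ (x + proc I M₂ j) (due I j)
          (subst (ℚ._≤ fromℕ (due I j)) (sym (fromℕ-+ x (proc I M₂ j)))
          (ℚ.≤-trans (ℚ.+-monoˡ-≤ (fromℕ (proc I M₂ j)) le) (ℚ.≤-reflexive (onTime refl j∈))))

      last-start : ∀ {c l v js} → Chain c l v (map toℕ js) →
                   All (λ i → i ∈ˢ E × due I i < due I j) js → fromℕ l ℚ.≤ start M₂ j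
      last-start {js = []}    [] _ = released M₂ j∈
      last-start {js = h ∷ _} (extend _ _ _ _) ((h∈ , lt) ∷ _)
        rewrite pad-toℕ {f = due I} h = second-order h∈ j∈ lt

      last≤ : l + q (toℕ j) ≤ d (toℕ j)
      last≤ = start+q≤due l (last-start chain below)

      end≤ : ∀ {i} → i ∈ˢ E × due I i < due I j → end i ℚ.≤ start M₂ j
      end≤ {i} (i∈ , lt) = ℚ.≤-trans (route refl i∈)
        (ℚ.≤-trans (ℚ.≤-trans (ℚ.≤-trans (ℚ.≤-reflexive (sym (ℚ.+-identityʳ _)))
          (ℚ.+-monoʳ-≤ (start M₂ i) (0≤fromℕ (proc I M₂ i)))) (ℚ.≤-reflexive (onTime refl i∈)))
            (second-order i∈ j∈ lt))

      -- By the time `j` starts on the second machine, `j` and all jobs with earlier due dates have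
      -- left the first one, in whatever order they ran there. Hence their total length fits before
      -- that time.
      loaded : fromℕ (load (map toℕ (j ∷ jobs))) ℚ.≤ start M₂ j
      loaded rewrite load-toℕ (j ∷ jobs) =
        total-length (length (j ∷ jobs)) (j ∷ jobs) ≤-refl
          (All.map (λ { (i∈ , lt) → capacity M₁ j∈ i∈ λ { refl → <-irrefl refl lt } })
             below ∷ apart)
          (released M₁ j∈ ∷ All.map (released M₁ ∘ proj₁) below)
          (route refl j∈ ∷ All.map end≤ below)
          (released M₂ j∈)

      time≤ : c + p (toℕ j) + q (toℕ j) ≤ d (toℕ j)
      time≤ = start+q≤due (c + p (toℕ j)) (subst (λ x → fromℕ x ℚ.≤ start M₂ j)
        (trans (+-comm (p (toℕ j)) _) (cong (_+ p (toℕ j)) (sym (chain-time chain)))) loaded)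

      here-weight : weightBelow (suc (due I j)) j ≡ weight I j
      here-weight rewrite <⇒<ᵇ≡true (n<1+n (due I j)) | []=⇒lookup j∈ = refl

      absent : weightBelow (due I j) j ≡ 0
      absent rewrite ≮⇒<ᵇ≡false (<-irrefl (refl {x = due I j})) = refl

      value′ : v + w (toℕ j) ≡ sum (weightBelow (suc (due I j)))
      value′ = begin
        v + w (toℕ j)                               ≡⟨ +-comm v _ ⟩
        w (toℕ j) + v                               ≡⟨ cong₂ _+_ (trans (pad-toℕ j) (sym here-weight)) total ⟩
        weightBelow (suc (due I j)) j + sum (weightBelow (due I j))
          ≡⟨ sym (sum-split _ (weightBelow (due I j)) j
               (λ k k≢j → weightBelow-other (due I j) k λ { (k∈ , eq) →
                 k≢j (due-injective k∈ j∈ eq) }) absent) ⟩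
        sum (weightBelow (suc (due I j)))           ∎
        where open ≡-Reasoning

    chain-below-all : ∀ {t} → (∀ j → due I j < t) → ChainBelow t →
                      ∃₂ λ c l → ∃ λ js → Chain c l (totalWeight I E) js
    chain-below-all {t} due<t cb =
      c , l , map toℕ jobs ,
      subst (λ v → Chain c l v (map toℕ jobs)) (trans total (sum-cong-≗ all)) chain
      where
      open ChainBelow cb

      all : ∀ j → weightBelow t j ≡ (if lookup E j then weight I j else 0)
      all j rewrite <⇒<ᵇ≡true (due<t j) = refl

    feasible-chain : ∃₂ λ c l → ∃ λ js → Chain c l (totalWeight I E) js
    feasible-chain = chain-below-all
      -- The sum of all due dates is at least each of them, so its successor lies beyond them all.
      (λ j → s≤s (≤-trans (m≤m+n _ _) (≤-reflexive (sym (sum-without (due I) j)))))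
      (chain-below (suc (sum (due I))))

-- The algorithm

-- (x , y) is the current class and (x′ , y′) the next one, with x′ = 0 if there is
-- none.  In the search for the shortest job b that extends entry s, m is its
-- first processing time, or 1 + x (more than that of any fitting job) if none has
-- been found.  E and N are the table sizes before processing the class and now.
#n #j #x #y #x′ #y′ #m #b #s #E #N #best : ℕ
#n = 0
#j = 1
#x = 2
#y = 3
#x′ = 4
#y′ = 5
#m = 6
#b = 7
#s = 8
#E = 9
#N = 10
#best = 11

#out #due #weight #p #q #time #last #value #parent #job : ℕ
#out = 0
#due = 1
#weight = 2
#p = 3
#q = 4
#time = 5
#last = 6
#value = 7
#parent = 8
#job = 9

beforeᶠ : Expr → Expr → Expr → Expr → Formula
beforeᶠ x y x′ y′ = (lit 1 ⊕ x ≤ᶠ x′) ∨ᶠ (x ≤ᶠ x′ ∧ᶠ lit 1 ⊕ y ≤ᶠ y′)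

increment : ℕ → Program
increment r = r ≔ lit 1 ⊕ reg r

-- As due dates are positive, `#x′` being 0 unambiguously means that there is no candidate yet.
improves : Formula
improves = beforeᶠ (reg #x) (reg #y) dⱼ wⱼ
        ∧ᶠ (reg #x′ ≤ᶠ lit 0 ∨ᶠ beforeᶠ dⱼ wⱼ (reg #x′) (reg #y′))
  where
  dⱼ = #due ⟦ reg #j ⟧
  wⱼ = #weight ⟦ reg #j ⟧

nextClass : Program
nextClass =
  #x′ ≔ lit 0 ⨾
  #j ≔ lit 0 ⨾
  while reg #j ≺ reg #n loop
    ifᵖ holds improves
    then (#x′ ≔ #due ⟦ reg #j ⟧ ⨾ #y′ ≔ #weight ⟦ reg #j ⟧ ⨾ increment #j)
    else increment #j

fits : Formula
fits = (dⱼ ≤ᶠ reg #x ∧ᶠ reg #x ≤ᶠ dⱼ ∧ᶠ wⱼ ≤ᶠ reg #y ∧ᶠ reg #y ≤ᶠ wⱼ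
         ∧ᶠ #last ⟦ reg #s ⟧ ⊕ qⱼ ≤ᶠ dⱼ ∧ᶠ #time ⟦ reg #s ⟧ ⊕ pⱼ ⊕ qⱼ ≤ᶠ dⱼ)
    ∧ᶠ lit 1 ⊕ pⱼ ≤ᶠ reg #m
  where
  dⱼ = #due ⟦ reg #j ⟧
  wⱼ = #weight ⟦ reg #j ⟧
  pⱼ = #p ⟦ reg #j ⟧
  qⱼ = #q ⟦ reg #j ⟧

-- The argument is the rest of the program, so that sequences nest to the right.
findJob : Program → Program
findJob P =
  #m ≔ lit 1 ⊕ reg #x ⨾
  #j ≔ lit 0 ⨾
  (while reg #j ≺ reg #n loop
    ifᵖ holds fits
    then (#m ≔ #p ⟦ reg #j ⟧ ⨾ #b ≔ reg #j ⨾ increment #j)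
    else increment #j) ⨾
  P

extendEntry : Program
extendEntry = findJob
  (ifᵖ holds (reg #m ≤ᶠ reg #x)
   then (
     #time ⟦ reg #N ⟧≔ #time ⟦ reg #s ⟧ ⊕ #p ⟦ reg #b ⟧ ⨾
     #last ⟦ reg #N ⟧≔ #due ⟦ reg #b ⟧ ⨾
     #value ⟦ reg #N ⟧≔ #value ⟦ reg #s ⟧ ⊕ #weight ⟦ reg #b ⟧ ⨾
     #parent ⟦ reg #N ⟧≔ reg #s ⨾
     #job ⟦ reg #N ⟧≔ reg #b ⨾
     increment #N ⨾
     increment #s)
   else increment #s)

processClass : Program
processClass =
  #x ≔ reg #x′ ⨾
  #y ≔ reg #y′ ⨾
  #s ≔ lit 0 ⨾
  -- Freezing the bound keeps the loop away from entries that the same class appends, so the table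
  -- at most doubles.
  #E ≔ reg #N ⨾
  (while reg #s ≺ reg #E loop extendEntry) ⨾
  nextClass

selectBest : Program → Program
selectBest P =
  #best ≔ lit 0 ⨾
  #s ≔ lit 0 ⨾
  (while reg #s ≺ reg #N loop
    ifᵖ holds (lit 1 ⊕ #value ⟦ reg #best ⟧ ≤ᶠ #value ⟦ reg #s ⟧)
    then (#best ≔ reg #s ⨾ increment #s)
    else increment #s) ⨾
  P

output : Program
output =
  while lit 0 ≺ reg #best loop
    (#out ⟦ #job ⟦ reg #best ⟧ ⟧≔ lit 1 ⨾
     #best ≔ #parent ⟦ reg #best ⟧)

solver : Program
solver =
  -- Arrays start at zero, so entry 0 already is the empty solution; the initial class `(0 , 0)`
  -- precedes that of every job.
  #N ≔ lit 1 ⨾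
  nextClass ⨾
  (while lit 0 ≺ reg #x′ loop processClass) ⨾
  selectBest output

-- Loop invariants and running time

length-cartesianProduct : ∀ {A B : Set} (xs : List A) (ys : List B) →
                          length (cartesianProduct xs ys) ≡ length xs * length ys
length-cartesianProduct []       ys = refl
length-cartesianProduct (x ∷ xs) ys = trans (length-++ (map (x ,_) ys))
  (cong₂ _+_ (length-map (x ,_) ys) (length-cartesianProduct xs ys))

module Correctness (I : Instance 2) where
  open Schedules I

  -- Some pairs may belong to no job; what counts is that every class occurs and that the length is
  -- `#d I * #w I`.
  classes : List (ℕ × ℕ)
  classes = cartesianProduct (deduplicate _≟_ (tabulate (due I)))
                             (deduplicate _≟_ (tabulate (weight I)))

  #classes : length classes ≡ #d I * #w I
  #classes = length-cartesianProduct (deduplicate _≟_ (tabulate (due I))) (deduplicate _≟_ (tabulate (weight I)))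

  job-class : ∀ {j} → j < n I → (d j , w j) ∈ classes
  job-class j<n
    rewrite sym (Fin.toℕ-fromℕ< j<n) | pad-toℕ {f = due I} (fromℕ< j<n)
          | pad-toℕ {f = weight I} (fromℕ< j<n) =
    ∈-cartesianProduct⁺ (∈-deduplicate⁺ _≟_ (∈-tabulate⁺ (fromℕ< j<n)))
                        (∈-deduplicate⁺ _≟_ (∈-tabulate⁺ (fromℕ< j<n)))

  -- Bounds how often the table can still double.
  remaining : ℕ → ℕ → ℕ
  remaining x y = length (filter (uncurry (before? x y)) classes)

  remaining-< : ∀ {x y x′ y′} → Before x y x′ y′ → (x′ , y′) ∈ classes →
                remaining x′ y′ < remaining x y
  remaining-< {x} {y} {x′} {y′} b ∈classes =
    length-filter-strict (uncurry (before? x′ y′)) (uncurry (before? x y))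
      (before-trans b) ∈classes before-irrefl b

  -- The predicates below take the contents of registers and arrays rather than
  -- the state, so that they are literally unchanged by assignments to others.
  record Encoded (n′ : ℕ) (o d′ w′ p′ q′ : ℕ → ℕ) : Set where
    constructor encoded
    field
      n-eq : n′ ≡ n I
      d-eq : d′ ≡ d
      w-eq : w′ ≡ w
      p-eq : p′ ≡ p
      q-eq : q′ ≡ q
      unmarked : ∀ i → o i ≡ 0

  module _ (n : ℕ) (d w p q : ℕ → ℕ) where
    open Jobs n d w p q

    -- The invariant of the loop over classes: `U` bounds the table size and `r` the number of
    -- classes to come.
    record Covered (U r : ℕ) (o : ℕ → ℕ) (T : Table) (x y N : ℕ) : Set where
      field
        encoding : Encoded n o d w p q
        nonempty : 0 < N
        valid    : Valid T N
        covers   : Covers T N x y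
        few      : remaining x y ≤ r
        small    : N ≤ U

    -- The state of the search for the next class after `k` jobs have been scanned.
    record NextClass (x y x′ y′ k : ℕ) : Set where
      field
        least : ∀ {i} → i < k → Before x y (d i) (w i) →
                0 < x′ × ¬ Before (d i) (w i) x′ y′
        found : 0 < x′ → Before x y x′ y′ × ∃ λ i → i < n × d i ≡ x′ × w i ≡ y′

    -- The invariant of the loop over entries: the first `E` entries cover everything up to the
    -- previous class `(x₀ , y₀)`, and each of the `s` visited ones has added at most one entry.
    record Extending (U r : ℕ) (o : ℕ → ℕ) (T : Table) (x₀ y₀ x y s E N : ℕ) : Set where
      field
        encoding : Encoded n o d w p q
        E>0      : 0 < E
        E≤N      : E ≤ N
        N≤E+s    : N ≤ E + s
        s≤E      : s ≤ E
        valid    : Valid T N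
        covers   : Covers T E x₀ y₀
        extended : ∀ {r} → r < s → Extended T N x y r
        least    : ∀ {i} → i < n → Before x₀ y₀ (d i) (w i) → ¬ Before (d i) (w i) x y
        few      : remaining x y ≤ r
        small    : E ≤ U

    -- The search starts with `m` equal to `1 + x`, so `m ≤ x` signals success.
    record FoundJob (x y c l m b k : ℕ) : Set where
      field
        least : ∀ {i} → i < k → Fits x y c l i → m ≤ p i
        found : m ≤ x → b < n × Fits x y c l b × m ≡ p b

  record Selecting (T : Table) (N s best : ℕ) : Set where
    field
      best<N  : best < N
      maximal : ∀ {r} → r < s → value T r ≤ value T best

  module At (σ : State) where
    n₁ = regs σ #n
    d₁ = arrays σ #due
    w₁ = arrays σ #weight
    p₁ = arrays σ #p
    q₁ = arrays σ #q

    T : Table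
    T = table (arrays σ #time) (arrays σ #last) (arrays σ #value)
              (arrays σ #parent) (arrays σ #job)

    isCovered : ℕ → ℕ → Set
    isCovered U r =
      Covered n₁ d₁ w₁ p₁ q₁ U r (arrays σ #out) T (regs σ #x) (regs σ #y) (regs σ #N)

    isNext : ℕ → Set
    isNext = NextClass n₁ d₁ w₁ p₁ q₁ (regs σ #x) (regs σ #y) (regs σ #x′) (regs σ #y′)

    isExtending : ℕ → ℕ → ℕ → ℕ → Set
    isExtending U r x₀ y₀ = Extending n₁ d₁ w₁ p₁ q₁ U r (arrays σ #out) T x₀ y₀
      (regs σ #x) (regs σ #y) (regs σ #s) (regs σ #E) (regs σ #N)

    isFound : ℕ → Set
    isFound = FoundJob n₁ d₁ w₁ p₁ q₁ (regs σ #x) (regs σ #y)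
      (arrays σ #time (regs σ #s)) (arrays σ #last (regs σ #s)) (regs σ #m) (regs σ #b)

    isSelecting : Set
    isSelecting = Selecting T (regs σ #N) (regs σ #s) (regs σ #best)

  open At using (isCovered; isNext; isExtending; isFound; isSelecting)

  module _ {n : ℕ} {d w p q : ℕ → ℕ} where

    next-update : ∀ {x y x′ y′ j} → NextClass n d w p q x y x′ y′ j → j < n → 0 < d j →
      Before x y (d j) (w j) × (x′ ≤ 0 ⊎ Before (d j) (w j) x′ y′) →
      NextClass n d w p q x y (d j) (w j) (suc j)
    next-update {j = j} nx j<n dⱼ>0 (after , better) = record
      { least = λ i<1+j b → dⱼ>0 , [ (λ i<j → earlier i<j b) , (λ { refl → before-irrefl }) ]′
                  (m≤n⇒m<n∨m≡n (s≤s⁻¹ i<1+j))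
      ; found = λ _ → after , j , j<n , refl , refl
      }
      where
      open NextClass nx
      earlier : ∀ {i} → i < j → Before _ _ (d i) (w i) → ¬ Before (d i) (w i) (d j) (w j)
      earlier i<j b b′ with least i<j b
      ... | x′>0 , least′ =
        [ <⇒≱ x′>0 , (λ b″ → least′ (before-trans b′ b″)) ]′ better

    next-keep : ∀ {x y x′ y′ j} → NextClass n d w p q x y x′ y′ j →
      ¬ (Before x y (d j) (w j) × (x′ ≤ 0 ⊎ Before (d j) (w j) x′ y′)) →
      NextClass n d w p q x y x′ y′ (suc j)
    next-keep nx ¬better = record
      { least = λ i<1+j b → [ (λ i<j → least i<j b)
                            , (λ { refl → ≰⇒> (λ x′≤0 → ¬better (b , inj₁ x′≤0))
                                        , (λ b′ → ¬better (b , inj₂ b′)) }) ]′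
                  (m≤n⇒m<n∨m≡n (s≤s⁻¹ i<1+j))
      ; found = found
      }
      where open NextClass nx

  encoded-d>0 : ∀ {n o d w p q j} → Encoded n o d w p q → j < n → 0 < d j
  encoded-d>0 (encoded refl refl refl refl refl _) = d>0

  -- A round costs 78 = 3 + 61 + 10 + 4: the loop test, the compiled `improves` and the two
  -- branches.
  nextClass-ends : ∀ {U r σ} → isCovered σ U r →
    Ends nextClass σ (λ σ′ → isCovered σ′ U r × isNext σ′ (n I)) (4 + (n I * 78 + 3))
  nextClass-ends {U} {r} {σ} cov = assign-seq (assign-seq (weaken (λ {σ} → post {σ}) ≤-refl
      (while-ends Inv body (n I) (cov , empty) (≤-reflexive (Encoded.n-eq (Covered.encoding cov))))))
    where
    Inv : State → Set
    Inv σ = isCovered σ U r × isNext σ (regs σ #j)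

    empty : isNext (σ [ #x′ := 0 ]) 0
    empty = record { least = λ () ; found = λ () }

    body : ∀ {σ} → Inv σ → regs σ #j < regs σ #n →
      Ends _ σ (λ σ′ → Inv σ′ × gap (reg #j) (reg #n) σ′ < gap (reg #j) (reg #n) σ) _
    body {σ} (cov , nx) j<n = if-ends improves
      (λ h → assign-seq (assign-seq (assign-ends
        ((cov , next-update nx j<n (encoded-d>0 (Covered.encoding cov) j<n) h) ,
         ∸-monoʳ-< (n<1+n (regs σ #j)) j<n))))
      (λ ¬h → assign-ends ((cov , next-keep nx ¬h) , ∸-monoʳ-< (n<1+n (regs σ #j)) j<n))

    post : ∀ {σ} → Inv σ × regs σ #n ≤ regs σ #j → isCovered σ U r × isNext σ (n I)
    post {σ} ((cov , nx) , n≤j) = cov , record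
      { least = λ i<n → NextClass.least nx
          (<-≤-trans i<n (subst (_≤ regs σ #j) (Encoded.n-eq (Covered.encoding cov)) n≤j))
      ; found = NextClass.found nx }

  module _ {n : ℕ} {d w p q : ℕ → ℕ} where
    open Jobs n d w p q

    encoded-q>0 : ∀ {o} → Encoded n o d w p q → ∀ {j} → j < n → 0 < q j
    encoded-q>0 (encoded refl refl refl refl refl _) = q>0

    module _ {x y c l m b j} (fj : FoundJob n d w p q x y c l m b j) where
      open FoundJob fj

      found-update : j < n → Fits x y c l j × p j < m →
                     FoundJob n d w p q x y c l (p j) j (suc j)
      found-update j<n (fit , pⱼ<m) = record
        { least = λ i<1+j fit′ →
            [ (λ i<j → ≤-trans (<⇒≤ pⱼ<m) (least i<j fit′)) , (λ { refl → ≤-refl }) ]′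
              (m≤n⇒m<n∨m≡n (s≤s⁻¹ i<1+j))
        ; found = λ _ → j<n , fit , refl
        }

      found-keep : ¬ (Fits x y c l j × p j < m) → FoundJob n d w p q x y c l m b (suc j)
      found-keep ¬better = record
        { least = λ i<1+j fit′ →
            [ (λ i<j → least i<j fit′) , (λ { refl → ≮⇒≥ λ lt → ¬better (fit′ , lt) }) ]′
              (m≤n⇒m<n∨m≡n (s≤s⁻¹ i<1+j))
        ; found = found
        }

    module _ {U r o T x₀ y₀ x y s E N m b k}
             (ext : Extending n d w p q U r o T x₀ y₀ x y s E N)
             (s<E : s < E) (n≤k : n ≤ k)
             (fj : FoundJob n d w p q x y (time T s) (last T s) m b k) where
      open Extending ext
      open FoundJob fj renaming (least to shortest)

      s<N : s < N
      s<N = <-≤-trans s<E E≤N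

      extending-append : m ≤ x →
        Extending n d w p q U r o (append T N s b) x₀ y₀ x y (suc s) E (suc N)
      extending-append m≤x with found m≤x
      ... | b<n , (b≤x , x≤b , b≤y , y≤b , h , h′) , m≡pb = record
        { encoding = encoding
        ; E>0      = E>0
        ; E≤N      = m≤n⇒m≤1+n E≤N
        ; N≤E+s    = ≤-trans (s≤s N≤E+s) (≤-reflexive (sym (+-suc E s)))
        ; s≤E      = s<E
        ; valid    = valid-append valid s<N b<n h h′
        ; covers   = covers-append {T = T} E≤N covers
        ; extended = λ {r} r<1+s →
            [ (λ r<s → extended-append {T = T} (<-trans r<s s<N) (extended r<s))
            , (λ { refl → extended-new {T = T} s<N (≤-antisym x≤b b≤x) (≤-antisym y≤b b≤y)
                     λ i<n fit → subst (_≤ _) m≡pb (shortest (<-≤-trans i<n n≤k) fit) }) ]′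
              (m≤n⇒m<n∨m≡n (s≤s⁻¹ r<1+s))
        ; least    = least
        ; few      = few
        ; small    = small
        }

      extending-skip : ¬ m ≤ x → Extending n d w p q U r o T x₀ y₀ x y (suc s) E N
      extending-skip m≰x = record
        { encoding = encoding
        ; E>0      = E>0
        ; E≤N      = E≤N
        ; N≤E+s    = ≤-trans N≤E+s (+-monoʳ-≤ E (n≤1+n s))
        ; s≤E      = s<E
        ; valid    = valid
        ; covers   = covers
        ; extended = λ {r} r<1+s →
            [ extended , (λ { refl i<n fit → contradiction (too-long i<n fit) m≰x }) ]′
              (m≤n⇒m<n∨m≡n (s≤s⁻¹ r<1+s))
        ; least    = least
        ; few      = few
        ; small    = small
        }
        where
        -- A fitting job satisfies `p i ≤ d i ≤ x`, so the search would have succeeded.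
        too-long : ∀ {i} → i < n → Fits x y (time T s) (last T s) i → m ≤ x
        too-long {i} i<n fit@(i≤x , _ , _ , _ , _ , h) = begin
          m                            ≤⟨ shortest (<-≤-trans i<n n≤k) fit ⟩
          p i                          ≤⟨ m≤n+m (p i) (time T s) ⟩
          time T s + p i         ≤⟨ m≤m+n _ (q i) ⟩
          time T s + p i + q i   ≤⟨ h ⟩
          d i                          ≤⟨ i≤x ⟩
          x                            ∎
          where open ≤-Reasoning

  -- The variant `g` of the outer loop is carried through the inner loop, so that the decrease after
  -- the continuation can be measured from the state before it. A round costs 65 = 3 + 49 + 9 + 4,
  -- with 49 for testing `fits`.
  findJob-ends : ∀ {P Q t U r x₀ y₀ g σ} →
    isExtending σ U r x₀ y₀ → regs σ #s < regs σ #E → gap (reg #s) (reg #E) σ ≡ g →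
    (∀ {σ′} → isExtending σ′ U r x₀ y₀ → regs σ′ #s < regs σ′ #E →
       gap (reg #s) (reg #E) σ′ ≡ g → (∃ λ k → regs σ′ #n ≤ k × isFound σ′ k) →
       Ends P σ′ Q t) →
    Ends (findJob P) σ Q (6 + (n I * 65 + 3 + t))
  findJob-ends {U = U} {r} {x₀} {y₀} {g} {σ} ext s<E gap≡g continue =
    assign-seq (assign-seq (seq-ends
      (while-ends Inv body (n I) ((ext , s<E , gap≡g) , empty)
        (≤-reflexive (Encoded.n-eq (Extending.encoding ext))))
      λ { {σ′} (((ext′ , s<E′ , gap≡g′) , found) , n≤j) →
          continue ext′ s<E′ gap≡g′ (_ , n≤j , found) }))
    where
    Inv : State → Set
    Inv σ = (isExtending σ U r x₀ y₀ × regs σ #s < regs σ #E ×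
             gap (reg #s) (reg #E) σ ≡ g) × isFound σ (regs σ #j)

    empty : isFound (σ [ #m := suc (regs σ #x) ]) 0
    empty = record { least = λ () ; found = λ h → contradiction h 1+n≰n }

    body : ∀ {σ} → Inv σ → regs σ #j < regs σ #n →
      Ends _ σ (λ σ′ → Inv σ′ × gap (reg #j) (reg #n) σ′ < gap (reg #j) (reg #n) σ) _
    body {σ} (rest , fj) j<n = if-ends fits
      (λ h → assign-seq (assign-seq (assign-ends
        ((rest , found-update fj j<n h) , ∸-monoʳ-< (n<1+n (regs σ #j)) j<n))))
      (λ ¬h → assign-ends
        ((rest , found-keep fj ¬h) , ∸-monoʳ-< (n<1+n (regs σ #j)) j<n))

  extendEntry-ends : ∀ {U r x₀ y₀ σ} →
    isExtending σ U r x₀ y₀ → regs σ #s < regs σ #E →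
    Ends extendEntry σ
      (λ σ′ → isExtending σ′ U r x₀ y₀ ×
              gap (reg #s) (reg #E) σ′ < gap (reg #s) (reg #E) σ)
      (6 + (n I * 65 + 3 + 41))
  extendEntry-ends {σ = σ} ext s<E = findJob-ends ext s<E refl
    λ { {σ′} ext′ s<E′ gap≡ (k , n≤k , found) →
      let decreases = <-≤-trans (∸-monoʳ-< (n<1+n (regs σ′ #s)) s<E′) (≤-reflexive gap≡) in
      if-ends (reg #m ≤ᶠ reg #x)
        (λ m≤x → store-seq (store-seq (store-seq (store-seq (store-seq (assign-seq
          (assign-ends (extending-append ext′ s<E′ n≤k found m≤x , decreases))))))))
        (λ m≰x → assign-ends (extending-skip ext′ s<E′ n≤k found m≰x , decreases)) }

  encoded-class : ∀ {n o d w p q j} → Encoded n o d w p q → j < n → (d j , w j) ∈ classes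
  encoded-class (encoded refl refl refl refl refl _) = job-class

  -- The class found is among the remaining ones, so `r` is positive and moving to that class uses
  -- up one unit.
  extending-start : ∀ {n d w p q U r o T x y x′ y′ N k} →
    Covered n d w p q U r o T x y N → NextClass n d w p q x y x′ y′ k → n ≤ k → 0 < x′ →
    ∃ λ r′ → r ≡ suc r′ × Extending n d w p q U r′ o T x y x′ y′ 0 N N
  extending-start {x = x} {y} {x′} {y′} {N} cov nx n≤k x′>0 = by-fuel few
    where
    open Covered cov
    open NextClass nx

    fewer : remaining x′ y′ < remaining x y
    fewer with found x′>0
    ... | b , i , i<n , refl , refl = remaining-< b (encoded-class encoding i<n)

    by-fuel : ∀ {r} → remaining x y ≤ r →
              ∃ λ r′ → r ≡ suc r′ × Extending _ _ _ _ _ _ r′ _ _ x y x′ y′ 0 N N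
    by-fuel {zero}   h = contradiction h (<⇒≱ (≤-<-trans z≤n fewer))
    by-fuel {suc r′} h = r′ , refl , record
      { encoding = encoding
      ; E>0      = nonempty
      ; E≤N      = ≤-refl
      ; N≤E+s    = m≤m+n N 0
      ; s≤E      = z≤n
      ; valid    = valid
      ; covers   = covers
      ; extended = λ ()
      ; least    = λ i<n b → proj₂ (least (<-≤-trans i<n n≤k) b)
      ; few      = s≤s⁻¹ (≤-trans fewer h)
      ; small    = small
      }

  extending-finish : ∀ {n d w p q U r o T x₀ y₀ x y s E N} →
    Extending n d w p q U r o T x₀ y₀ x y s E N → E ≤ s →
    Covered n d w p q (U + U) r o T x y N
  extending-finish {n} {d} {w} {p} {q} {T = T} {E = E} {N} ext E≤s = record
    { encoding = encoding
    ; nonempty = <-≤-trans E>0 E≤N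
    ; valid    = valid
    ; covers   = Jobs.covers-next n d w p q (encoded-q>0 encoding) {T = T} E≤N covers
                   (λ r<E → extended (<-≤-trans r<E E≤s)) least
    ; few      = few
    ; small    = ≤-trans N≤E+s (+-mono-≤ small (≤-trans s≤E small))
    }
    where open Extending ext

  classTime : ℕ → ℕ
  classTime U = 8 + (U * (3 + (6 + (n I * 65 + 3 + 41))) + 3 + (4 + (n I * 78 + 3)))

  processClass-ends : ∀ {U r σ} → isCovered σ U r → isNext σ (n I) → 0 < regs σ #x′ →
    Ends processClass σ
      (λ σ′ → (∃ λ r′ → r ≡ suc r′ × isCovered σ′ (U + U) r′) × isNext σ′ (n I))
      (classTime U)
  processClass-ends {U} cov nx x′>0
    with extending-start cov nx (≤-reflexive (Encoded.n-eq (Covered.encoding cov))) x′>0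
  ... | r′ , refl , ext = assign-seq (assign-seq (assign-seq (assign-seq (seq-ends
    (while-ends (λ σ → isExtending σ U r′ _ _) extendEntry-ends U ext (Covered.small cov))
    λ {σ′} (ext′ , E≤s) → weaken (λ (cov′ , nx′) → (r′ , refl , cov′) , nx′) ≤-refl
      (nextClass-ends {σ = σ′} (extending-finish ext′ E≤s))))))

  -- The work on r more classes in units of the work on the present table, which
  -- every class can double.
  iterations : ℕ → ℕ
  iterations zero    = 1
  iterations (suc r) = suc (iterations r + iterations r)

  iterations>0 : ∀ r → 0 < iterations r
  iterations>0 zero    = ≤-refl
  iterations>0 (suc r) = s≤s z≤n

  -- `iterations r` is exactly one less than `2 ^ suc r`; including the extra one makes the bound
  -- inductive.
  iterations≤ : ∀ r → suc (iterations r) ≤ 2 ^ suc r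
  iterations≤ zero    = ≤-refl
  iterations≤ (suc r) = begin
    2 + (iterations r + iterations r)       ≡⟨ sym (cong suc (+-suc (iterations r) _)) ⟩
    suc (iterations r) + suc (iterations r) ≤⟨ +-mono-≤ (iterations≤ r) (iterations≤ r) ⟩
    2 ^ suc r + 2 ^ suc r                   ≡⟨ cong (2 ^ suc r +_) (sym (+-identityʳ _)) ⟩
    2 ^ suc (suc r)                         ∎
    where open ≤-Reasoning

  module _ where
    open ≤-Reasoning

    -- Each of 1, `u`, `m * u` and `m` is at most `(m ⊔ 1) * u`. The maximum with 1 lets constant
    -- costs be absorbed even for `m = 0`.
    affine-bound : ∀ a b c e m u → 0 < u →
      a + (u * (b + m * c) + m * e) ≤ (a + b + c + e) * ((m ⊔ 1) * u)
    affine-bound a b c e m u 0<u = begin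
      a + (u * (b + m * c) + m * e)           ≡⟨ expand a b c e m u ⟩
      1 * a + u * b + (m * u) * c + m * e     ≤⟨ +-mono-≤ (+-mono-≤ (+-mono-≤
                                                   (*-monoˡ-≤ a 1≤z) (*-monoˡ-≤ b u≤z))
                                                   (*-monoˡ-≤ c (*-monoˡ-≤ u (m≤m⊔n m 1))))
                                                   (*-monoˡ-≤ e m≤z) ⟩
      z * a + z * b + z * c + z * e           ≡⟨ collect z a b c e ⟩
      (a + b + c + e) * z                     ∎
      where
      z = (m ⊔ 1) * u
      1≤z : 1 ≤ z
      1≤z = *-mono-≤ (m≤n⊔m m 1) 0<u
      u≤z : u ≤ z
      u≤z = ≤-trans (≤-reflexive (sym (*-identityˡ u))) (*-monoˡ-≤ u (m≤n⊔m m 1))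
      m≤z : m ≤ z
      m≤z = ≤-trans (≤-reflexive (sym (*-identityʳ m))) (*-mono-≤ (m≤m⊔n m 1) 0<u)
      expand : ∀ a b c e m u → a + (u * (b + m * c) + m * e) ≡
               1 * a + u * b + (m * u) * c + m * e
      expand = solve-∀
      collect : ∀ z a b c e → z * a + z * b + z * c + z * e ≡ (a + b + c + e) * z
      collect = solve-∀

  -- Linear in `U`, and 300 exceeds 217 = 21 + 53 + 65 + 78, the sum of the coefficients of
  -- `3 + classTime U`.
  levelTime : ℕ → ℕ
  levelTime U = 300 * ((n I ⊔ 1) * U)

  classTime≤ : ∀ {U} → 0 < U → 3 + classTime U ≤ levelTime U
  classTime≤ {U} 0<U = begin
    3 + classTime U                            ≡⟨ rearrange U (n I) ⟩
    21 + (U * (53 + n I * 65) + n I * 78)      ≤⟨ affine-bound 21 53 65 78 (n I) U 0<U ⟩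
    217 * ((n I ⊔ 1) * U)                      ≤⟨ *-monoˡ-≤ ((n I ⊔ 1) * U) (m≤m+n 217 83) ⟩
    levelTime U                                ∎
    where
    open ≤-Reasoning
    rearrange : ∀ U m → 3 + (8 + (U * (3 + (6 + (m * 65 + 3 + 41))) + 3 + (4 + (m * 78 + 3))))
                      ≡ 21 + (U * (53 + m * 65) + m * 78)
    rearrange = solve-∀

  Searched : ℕ → State → Set
  Searched B σ = (∃ λ r → isCovered σ B r) × isNext σ (n I) × regs σ #x′ ≤ 0

  -- Rounds become dearer as the table doubles, so the uniform cost per round of `while-ends` would
  -- be too coarse. Recursion on `r` sums a geometric series instead.
  search-ends : ∀ r {U σ} → isCovered σ U r → isNext σ (n I) →
    Ends (while lit 0 ≺ reg #x′ loop processClass) σ (Searched (U * 2 ^ r))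
      (levelTime U * iterations r)
  search-ends r {U} {σ} cov nx with 0 <? regs σ #x′
  -- The search may stop with `r` still positive; both bounds only grow with `r`.
  ... | no x′≯0 = _ , _ , whileFalse (≮⇒<ᵇ≡false x′≯0) ,
    ((r , record { Covered cov
                 ; small = ≤-trans (Covered.small cov) (m≤m*n U (2 ^ r) {{m^n≢0 2 r}}) }) ,
     nx , ≮⇒≥ x′≯0) ,
    ≤-trans (≤-trans (m≤m+n 3 _) (classTime≤ U>0))
            (m≤m*n _ (iterations r) {{>-nonZero (iterations>0 r)}})
    where U>0 = <-≤-trans (Covered.nonempty cov) (Covered.small cov)
  ... | yes x′>0 with processClass-ends {σ = σ} cov nx x′>0
  ...   | σ₁ , t₁ , run₁ , ((r′ , refl , cov′) , nx′) , t₁≤ with search-ends r′ {σ = σ₁} cov′ nx′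
  ...     | σ₂ , t₂ , run₂ , searched , t₂≤ =
    σ₂ , _ , whileTrue (<⇒<ᵇ≡true x′>0) run₁ run₂ ,
    subst (λ B → Searched B σ₂) (level U (2 ^ r′)) searched ,
    (begin
      3 + t₁ + t₂                                          ≤⟨ +-mono-≤ (+-monoʳ-≤ 3 t₁≤) t₂≤ ⟩
      3 + classTime U + levelTime (U + U) * iterations r′  ≤⟨ +-monoˡ-≤ _ (classTime≤ U>0) ⟩
      levelTime U + levelTime (U + U) * iterations r′      ≡⟨ double (n I ⊔ 1) U (iterations r′) ⟩
      levelTime U * iterations (suc r′)                    ∎)
    where
    open ≤-Reasoning
    U>0 = <-≤-trans (Covered.nonempty cov) (Covered.small cov)
    level : ∀ u t → (u + u) * t ≡ u * (2 * t)
    level = solve-∀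
    double : ∀ m u g → 300 * (m * u) + 300 * (m * (u + u)) * g ≡ 300 * (m * u) * (1 + (g + g))
    double = solve-∀

  -- Selecting and reading off an optimal solution

  Optimum : List ℕ → Set
  Optimum js = ∃ λ c → ∃₂ λ l v → Chain c l v js ×
    (∀ {c′ l′ v′ js′} → Chain c′ l′ v′ js′ → v′ ≤ v)
    where open Jobs (n I) d w p q

  record Finished (n : ℕ) (o d w p q : ℕ → ℕ) (T : Table) (B N : ℕ) : Set where
    open Jobs n d w p q
    field
      encoding : Encoded n o d w p q
      nonempty : 0 < N
      bounded  : N ≤ B
      valid    : Valid T N
      complete : ∀ {c l v js} → Chain c l v js → ∃ λ r → r < N × v ≤ value T r

  isFinished : ℕ → State → Set
  isFinished B σ = Finished (regs σ #n) (arrays σ #out) (arrays σ #due) (arrays σ #weight)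
    (arrays σ #p) (arrays σ #q) (At.T σ) B (regs σ #N)

  searched-finished : ∀ {B σ} → Searched B σ → isFinished B σ
  searched-finished {σ = σ} ((r , cov) , nx , x′≤0) = record
    { encoding = encoding
    ; nonempty = nonempty
    ; bounded  = small
    ; valid    = valid
    ; complete = λ {c} {l} {v} ch → case covers ch (all ch) of λ
        { (r , r<N , _ , _ , le) → r , r<N , le }
    }
    where
    open Covered cov
    open Jobs (regs σ #n) (arrays σ #due) (arrays σ #weight) (arrays σ #p) (arrays σ #q)

    -- A job beyond the current class would have produced a next class.
    all : ∀ {c l v js} → Chain c l v js → UpTo (regs σ #x) (regs σ #y) js
    all [] = tt
    all (extend _ j<n _ _) b = contradiction x′≤0 (<⇒≱ (proj₁
      (NextClass.least nx (<-≤-trans j<n (≤-reflexive (Encoded.n-eq encoding))) b)))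

  -- The invariant of `output`: marked jobs and jobs still on the trace together make up `js`.
  record Tracing (js : List ℕ) (o : ℕ → ℕ) (T : Table) (best : ℕ) : Set where
    field
      {rest} : List ℕ
      trace  : Trace T best rest
      marked : ∀ {i} → 0 < o i → i ∈ js
      rest⊆  : ∀ {i} → i ∈ rest → i ∈ js
      cover  : ∀ {i} → i ∈ js → 0 < o i ⊎ i ∈ rest

  isTracing : List ℕ → State → Set
  isTracing js σ = Tracing js (arrays σ #out) (At.T σ) (regs σ #best)

  finished-optimum : ∀ {n o d w p q T B N s best} → Finished n o d w p q T B N →
    Selecting T N s best → N ≤ s → ∃ λ js → Optimum js × Tracing js o T best
  finished-optimum {T = T} {best = best} fin sel N≤s
    with Finished.encoding fin | Finished.valid fin best (Selecting.best<N sel)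
  ... | encoded refl refl refl refl refl zeros | js , tr , ch = js ,
    ( _ , _ , value T best , ch
    , λ ch′ → case Finished.complete fin ch′ of λ
        { (r , r<N , le) → ≤-trans le (Selecting.maximal sel (<-≤-trans r<N N≤s)) }) ,
    record
      { trace  = tr
      ; marked = λ {i} 0<oᵢ → contradiction (zeros i) (≢-sym (<⇒≢ 0<oᵢ))
      ; rest⊆  = id
      ; cover  = inj₂
      }

  tracing-step : ∀ {js o T best} → Tracing js o T best → 0 < best →
    Tracing js (o [ job T best ↦ 1 ]) T (parent T best) × parent T best < best
  tracing-step record { trace = root } 0<0 = contradiction 0<0 1+n≰n
  tracing-step {js} {o} {T} {best}
    record { trace = step {js = rest} lt tr ; marked = marked ; rest⊆ = rest⊆ ; cover = cover } _ =
    record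
      { trace  = tr
      ; marked = marked′
      ; rest⊆  = rest⊆ ∘ there
      ; cover  = λ i∈ → [ inj₁ ∘ still-marked , (λ { (here refl) → inj₁ newly-marked
                                                   ; (there i∈rest) → inj₂ i∈rest }) ]′ (cover i∈)
      } , lt
    where
    k = job T best
    o′ = o [ k ↦ 1 ]

    newly-marked : 0 < o′ k
    newly-marked = ≤-reflexive (sym (update-same o k))

    still-marked : ∀ {i} → 0 < o i → 0 < o′ i
    still-marked {i} 0<oᵢ with i ≟ k
    ... | yes refl = newly-marked
    ... | no i≢k   = <-≤-trans 0<oᵢ (≤-reflexive (sym (update-other o i≢k)))

    marked′ : ∀ {i} → 0 < o′ i → i ∈ js
    marked′ {i} 0<o′ᵢ with i ≟ k
    ... | yes i≡k = rest⊆ (here i≡k)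
    ... | no i≢k  = marked (<-≤-trans 0<o′ᵢ (≤-reflexive (update-other o i≢k)))

  output-ends : ∀ {js B σ} → isTracing js σ → regs σ #best ≤ B →
    Ends output σ (λ σ′ → isTracing js σ′ × regs σ′ #best ≤ 0) (B * 10 + 3)
  output-ends {js} {B} tracing best≤B =
    while-ends (isTracing js)
      (λ tr 0<best → store-seq (assign-ends (tracing-step tr 0<best)))
      B tracing best≤B

  select-update : ∀ {T N s best} → Selecting T N s best → s < N →
    value T best < value T s → Selecting T N (suc s) s
  select-update {s = s} sel s<N lt = record
    { best<N  = s<N
    ; maximal = λ r<1+s →
        [ (λ r<s → ≤-trans (Selecting.maximal sel r<s) (<⇒≤ lt)) , (λ { refl → ≤-refl }) ]′
          (m≤n⇒m<n∨m≡n (s≤s⁻¹ r<1+s))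
    }

  select-keep : ∀ {T N s best} → Selecting T N s best →
    ¬ value T best < value T s → Selecting T N (suc s) best
  select-keep sel ≮ = record
    { best<N  = Selecting.best<N sel
    ; maximal = λ r<1+s → [ Selecting.maximal sel , (λ { refl → ≮⇒≥ ≮ }) ]′
                            (m≤n⇒m<n∨m≡n (s≤s⁻¹ r<1+s))
    }

  selectBest-ends : ∀ {B σ} → isFinished B σ →
    Ends (selectBest output) σ
      (λ σ′ → ∃ λ js → Optimum js × isTracing js σ′ × regs σ′ #best ≤ 0)
      (4 + ((B * 22 + 3) + (B * 10 + 3)))
  selectBest-ends {B} {σ} fin = assign-seq (assign-seq (seq-ends
    (while-ends Inv body B (fin , start) (Finished.bounded fin))
    λ {σ′} ((fin′ , sel) , N≤s) → case finished-optimum fin′ sel N≤s of λ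
      { (js , opt , tracing) → weaken (λ (tr , best≤0) → js , opt , tr , best≤0) ≤-refl
          (output-ends {σ = σ′} tracing
            (≤-trans (<⇒≤ (Selecting.best<N sel)) (Finished.bounded fin′))) }))
    where
    Inv : State → Set
    Inv σ = isFinished B σ × isSelecting σ

    start : isSelecting (σ [ #best := 0 ] [ #s := 0 ])
    start = record { best<N = Finished.nonempty fin ; maximal = λ () }

    body : ∀ {σ} → Inv σ → regs σ #s < regs σ #N →
      Ends _ σ (λ σ′ → Inv σ′ × gap (reg #s) (reg #N) σ′ < gap (reg #s) (reg #N) σ) _
    body {σ} (fin , sel) s<N = if-ends (lit 1 ⊕ #value ⟦ reg #best ⟧ ≤ᶠ #value ⟦ reg #s ⟧)
      (λ lt → assign-seq (assign-ends
        ((fin , select-update sel s<N lt) , ∸-monoʳ-< (n<1+n (regs σ #s)) s<N)))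
      (λ ≮ → assign-ends
        ((fin , select-keep sel ≮) , ∸-monoʳ-< (n<1+n (regs σ #s)) s<N))

  traced-optimal : ∀ {js σ} → Optimum js → isTracing js σ → regs σ #best ≤ 0 →
                   Optimal I (outputSet I σ)
  traced-optimal {js} {σ} (c , l , v , chain , maximal) tracing best≤0 =
    chain-feasible chain E ⊆js ,
    λ E′ S → case feasible-chain E′ S of λ
      { (_ , _ , _ , chain′) → ≤-trans (maximal chain′) (chain-weight chain E js⊆) }
    where
    E = outputSet I σ
    open Tracing tracing

    in-output : ∀ j → lookup E j ≡ (0 <ᵇ arrays σ #out (toℕ j))
    in-output = lookup∘tabulate _

    ⊆js : ∀ {j} → j ∈ˢ E → toℕ j ∈ js
    ⊆js {j} j∈ = marked (<ᵇ⇒< 0 _ (Equivalence.from T-≡ (trans (sym (in-output j)) ([]=⇒lookup j∈))))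

    finished : ∀ {r js} → r ≤ 0 → Trace (At.T σ) r js → ∀ {i} → ¬ i ∈ js
    finished z≤n (step () _)

    js⊆ : ∀ {j} → toℕ j ∈ js → j ∈ˢ E
    js⊆ {j} j∈ with cover j∈
    ... | inj₁ 0<oⱼ  = lookup⇒[]= j E (trans (in-output j) (<⇒<ᵇ≡true 0<oⱼ))
    ... | inj₂ j∈rest = contradiction j∈rest (finished best≤0 trace)

  k : ℕ
  k = #d I * #w I

  initial-covered : isCovered (encodeInstance I [ #N := 1 ]) 1 k
  initial-covered = record
    { encoding = encoded refl refl refl refl refl (pad-zero {n I})
    ; nonempty = ≤-refl
    ; valid    = λ { zero _ → [] , root , Jobs.[] ; (suc _) (s≤s ()) }
    -- Due dates are positive, so every class lies after `(0 , 0)` and only the empty chain has to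
    -- be covered.
    ; covers   = λ { Jobs.[] _ → 0 , ≤-refl , z≤n , z≤n , z≤n
                   ; (Jobs.extend _ j<n _ _) ¬b → contradiction (inj₁ (d>0 j<n)) ¬b }
    ; few      = ≤-trans (length-filter (uncurry (before? 0 0)) classes) (≤-reflexive #classes)
    ; small    = ≤-refl
    }
    where
    pad-zero : ∀ {m} i → pad {n = m} 0 (λ _ → 0) i ≡ 0
    pad-zero {zero}  i       = refl
    pad-zero {suc m} zero    = refl
    pad-zero {suc m} (suc i) = pad-zero {m} i

  solver-ends : Ends solver (encodeInstance I) (Optimal I ∘ outputSet I)
                  (729 * ((n I ⊔ 1) * 2 ^ k))
  solver-ends = weaken (λ {σ} (js , opt , tr , best≤0) → traced-optimal {σ = σ} opt tr best≤0) total
    (assign-seq (seq-ends (nextClass-ends {σ = encodeInstance I [ #N := 1 ]} initial-covered)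
      λ {σ₁} (cov , nx) → seq-ends (search-ends k {σ = σ₁} cov nx)
        λ {σ₂} searched → selectBest-ends {σ = σ₂} (searched-finished {σ = σ₂} searched)))
    where
    open ≤-Reasoning
    t = 2 ^ k
    z = (n I ⊔ 1) * t

    iterations≤2t : iterations k ≤ 2 * t
    iterations≤2t = ≤-trans (n≤1+n _) (iterations≤ k)

    rearrange : ∀ m m′ g t →
      2 + ((4 + (m * 78 + 3)) + (300 * (m′ * 1) * g + (4 + ((1 * t * 22 + 3) + (1 * t * 10 + 3)))))
      ≡ 19 + (t * (32 + m * 0) + m * 78) + 300 * m′ * g
    rearrange = solve-∀

    -- 129 = 19 + 32 + 0 + 78 accounts for set-up, selection and output, and 600 = 300 * 2 for the
    -- search.
    collect : ∀ m t → 129 * (m * t) + 300 * m * (2 * t) ≡ 729 * (m * t)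
    collect = solve-∀

    total : 2 + ((4 + (n I * 78 + 3)) + (levelTime 1 * iterations k +
              (4 + ((1 * t * 22 + 3) + (1 * t * 10 + 3))))) ≤ 729 * z
    total = begin
      _ ≡⟨ rearrange (n I) (n I ⊔ 1) (iterations k) t ⟩
      19 + (t * (32 + n I * 0) + n I * 78) + 300 * (n I ⊔ 1) * iterations k
        ≤⟨ +-mono-≤ (affine-bound 19 32 0 78 (n I) t (m^n>0 2 k))
                    (*-monoʳ-≤ (300 * (n I ⊔ 1)) iterations≤2t) ⟩
      129 * z + 300 * (n I ⊔ 1) * (2 * t)
        ≡⟨ collect (n I ⊔ 1) t ⟩
      729 * z ∎

-- The computable parameter bound and tractability

doubling : ℕ → ℕ → Program
doubling r c = while lit 0 ≺ reg c loop (r ≔ reg r ⊕ reg r ⨾ c ≔ reg c ⊖ lit 1)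

-- Without multiplication, powers of two arise by repeated doubling; register `r` times 2 to the
-- power of register `c` is invariant.
doubling-ends : ∀ r c {σ} → r ≢ c →
  Ends (doubling r c) σ (λ σ′ → regs σ′ r ≡ regs σ r * 2 ^ regs σ c) (regs σ c * 11 + 3)
doubling-ends r c {σ} r≢c = weaken (λ {σ′} → finish {σ′}) ≤-refl
  (while-ends Inv (λ {σ₁} → body {σ₁}) (regs σ c) refl ≤-refl)
  where
  Inv : State → Set
  Inv σ′ = regs σ′ r * 2 ^ regs σ′ c ≡ regs σ r * 2 ^ regs σ c

  halve : ∀ v t → (v + v) * t ≡ v * (2 * t)
  halve = solve-∀

  shift : ∀ v {e} → 0 < e → (v + v) * 2 ^ (e ∸ 1) ≡ v * 2 ^ e
  shift v {suc e} _ = halve v (2 ^ e)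

  body : ∀ {σ₁} → Inv σ₁ → 0 < regs σ₁ c →
    Ends (r ≔ reg r ⊕ reg r ⨾ c ≔ reg c ⊖ lit 1) σ₁
      (λ σ′ → Inv σ′ × regs σ′ c < regs σ₁ c) 8
  body {σ₁} inv 0<c = assign-seq (assign-ends
    ( trans (cong₂ (λ v e → v * 2 ^ e) r-value c-value) (trans (shift (regs σ₁ r) 0<c) inv)
    , subst (_< regs σ₁ c) (sym c-value) (∸-monoʳ-< ≤-refl 0<c)))
    where
    ρ = regs σ₁ [ r ↦ regs σ₁ r + regs σ₁ r ]
    r-value : (ρ [ c ↦ ρ c ∸ 1 ]) r ≡ regs σ₁ r + regs σ₁ r
    r-value = trans (update-other ρ r≢c) (update-same (regs σ₁) r)
    c-value : (ρ [ c ↦ ρ c ∸ 1 ]) c ≡ regs σ₁ c ∸ 1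
    c-value = trans (update-same ρ c) (cong (_∸ 1) (update-other (regs σ₁) (≢-sym r≢c)))

  finish : ∀ {σ′} → Inv σ′ × regs σ′ c ≤ 0 → regs σ′ r ≡ regs σ r * 2 ^ regs σ c
  finish {σ′} (inv , c≤0) rewrite n≤0⇒n≡0 c≤0 = trans (sym (*-identityʳ _)) inv

-- The first doubling leaves `2 ^ x` in register 1, which then counts the rounds of the second.
doubleExponential-computable : ∀ c → Computable (λ x → c * 2 ^ (2 ^ x))
doubleExponential-computable c = _ , λ x → computes x
  where
  program : Program
  program = 1 ≔ lit 1 ⨾ doubling 1 0 ⨾ 0 ≔ lit c ⨾ doubling 0 1

  computes : ∀ x → ∃₂ λ σ t →
    ⟨ program , ⟨ (λ _ → 0) [ 0 ↦ x ] ∣ (λ _ _ → 0) ⟩ ⟩⇓⟨ σ , t ⟩ × regs σ 0 ≡ c * 2 ^ (2 ^ x)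
  computes x with doubling-ends 1 0 {⟨ (λ _ → 0) [ 0 ↦ x ] ∣ (λ _ _ → 0) ⟩ [ 1 := 1 ]} (λ ())
  ... | σ₁ , _ , run₁ , eq₁ , _ with doubling-ends 0 1 {σ₁ [ 0 := c ]} (λ ())
  ... | σ₂ , _ , run₂ , eq₂ , _ =
    σ₂ , _ , seq assign (seq run₁ (seq assign run₂)) ,
    trans eq₂ (cong (λ m → c * 2 ^ m) (trans eq₁ (*-identityˡ (2 ^ x))))

m≤2^m : ∀ m → m ≤ 2 ^ m
m≤2^m zero    = z≤n
m≤2^m (suc m) = begin
  1 + m              ≤⟨ +-mono-≤ (m^n>0 2 m) (m≤2^m m) ⟩
  2 ^ m + 2 ^ m      ≡⟨ cong (2 ^ m +_) (sym (+-identityʳ _)) ⟩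
  2 ^ suc m          ∎
  where open ≤-Reasoning

-- Trades the product in the exponent for a power of the combined parameter, which doubling can
-- compute.
m*n≤2^[m+n] : ∀ m n → m * n ≤ 2 ^ (m + n)
m*n≤2^[m+n] m n = ≤-trans (*-mono-≤ (m≤2^m m) (m≤2^m n))
  (≤-reflexive (sym (^-distribˡ-+-* 2 m n)))

n≤sum : ∀ {n} (f : Fin n → ℕ) → (∀ j → 0 < f j) → n ≤ sum f
n≤sum {zero}  f _   = z≤n
n≤sum {suc n} f f>0 = +-mono-≤ (f>0 Fin.zero) (n≤sum (f ∘ Fin.suc) (f>0 ∘ Fin.suc))

-- Every job contributes at least one digit, and `bits (n I)` is positive even without jobs.
n⊔1≤size : ∀ (I : Instance 2) → n I ⊔ 1 ≤ size I
n⊔1≤size I = ⊔-lub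
  (≤-trans (n≤sum _ (λ j → s≤s z≤n)) (m≤n+m _ (bits (n I))))
  (s≤s z≤n)

theorem4 : (∃₂ λ P c → SolvesIn (JITFlowShop 2) P
    (λ I → c * ((n I ⊔ 1) * 2 ^ (#d I * #w I))))
    × FPT (JITFlowShop 2) (λ I → #d I + #w I)
theorem4 =
  (solver , 729 , Correctness.solver-ends) ,
  solver , (λ κ → 729 * 2 ^ (2 ^ κ)) , 1 , doubleExponential-computable 729 ,
  λ I → weaken id (fpt-bound I) (Correctness.solver-ends I)
  where
  fpt-bound : ∀ I → 729 * ((n I ⊔ 1) * 2 ^ (#d I * #w I)) ≤
                    729 * 2 ^ (2 ^ (#d I + #w I)) * size I ^ 1
  fpt-bound I = begin
    729 * ((n I ⊔ 1) * 2 ^ (#d I * #w I))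
      ≤⟨ *-monoʳ-≤ 729 (*-mono-≤ (n⊔1≤size I)
           (^-monoʳ-≤ 2 (m*n≤2^[m+n] (#d I) (#w I)))) ⟩
    729 * (size I * 2 ^ (2 ^ (#d I + #w I)))
      ≡⟨ regroup (size I) (2 ^ (2 ^ (#d I + #w I))) ⟩
    729 * 2 ^ (2 ^ (#d I + #w I)) * size I ^ 1 ∎
    where
    open ≤-Reasoning
    regroup : ∀ s t → 729 * (s * t) ≡ 729 * t * (s * 1)
    regroup = solve-∀
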